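{- Let $H$ be a fixed graph and $k$ a fixed positive integer. If $H$ has a subgraph $H'$ such that there exists a graph homomorphism from $H$ to $H'$, then $$h(n, k, H') \le h(n, k, H) \le h(n, k, H')+o(n^2),$$ where the $o(n^2)$ term is as $n\to\infty$ (with $H$, $H'$, $k$ fixed).
   Context: All graphs are finite, undirected and simple. A graph is $H$-free if it does not contain $H$ as a (not necessarily induced) subgraph. For a graph $G$ and a positive integer $k$, $h(G,k)$ is the minimum number of edges that can be deleted from $G$ so that the remaining graph is $k$-colorable. For a graph $H$ and positive integers $n,k$, $h(n,k,H)$ is the maximum of $h(G,k)$ over all $H$-free graphs $G$ on $n$ vertices (taken to be $0$ if there is no such graph). A homomorphism from $H$ to $H'$ is a (not necessarily injective) map $V(H)\to V(H')$ sending edges of $H$ to edges of $H'$. -}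

module Defs where

open import Data.Bool.Base using (Bool; T)
open import Data.Fin.Base using (Fin; zero; suc; finToFun; funToFin; fromℕ<)
open import Data.Fin.Properties using (_≟_; _<?_; any?; all?; finToFun-funToFin)
open import Data.Integer.Base using (+_)
open import Data.List.Base using (length; filter; cartesianProduct; allFin)
open import Data.List.Properties using (length-filter; filter-≐)
open import Data.Nat.Base
  using (ℕ; zero; suc; _≤_; _<_; _≥_; _^_; NonZero; >-nonZero⁻¹; s≤s⁻¹)
import Data.Nat.Properties as ℕ
open import Data.Product.Base using (Σ; ∃; ∃-syntax; _×_; _,_; proj₁; proj₂)
open import Data.Rational.Base as ℚ using (ℚ; 0ℚ; _/_)
open import Data.Sum.Base using (_⊎_; inj₁; inj₂; [_,_])
open import Function.Base using (_∘_)
open import Function.Definitions using (Injective)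
open import Relation.Binary.Core using (Rel)
open import Relation.Binary.Definitions using () renaming (Decidable to Decidable₂)
open import Relation.Binary.PropositionalEquality
  using (_≡_; _≢_; refl; sym; trans; cong; subst; subst₂)
open import Relation.Nullary using (Dec; ¬_; yes; no; contradiction)
open import Relation.Nullary.Decidable
  using (⌊_⌋; toWitness; fromWitness; map′; ¬?; T?; _×-dec_; _→-dec_)
open import Relation.Unary using (Pred; Decidable)
open import Level using (0ℓ)

record Graph (n : ℕ) : Set where
  field
    adj : Fin n → Fin n → Bool

  Adj : Rel (Fin n) 0ℓ
  Adj i j = T (adj i j)

  field
    adj-sym    : ∀ {i j} → Adj i j → Adj j i
    adj-irrefl : ∀ {i} → ¬ Adj i i

open Graph public

-- Each edge {i , j} is counted once, as the pair with i < j.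
#edges : ∀ {n} → Graph n → ℕ
#edges {n} G =
  length (filter (λ (i , j) → (i <? j) ×-dec T? (adj G i j))
                 (cartesianProduct (allFin n) (allFin n)))

IsHom : ∀ {m n} → Graph m → Graph n → (Fin m → Fin n) → Set
IsHom G H f = ∀ i j → Adj G i j → Adj H (f i) (f j)

Hom : ∀ {m n} → Graph m → Graph n → Set
Hom G H = ∃[ f ] IsHom G H f

-- G has a (not necessarily induced, not necessarily spanning) subgraph
-- isomorphic to H.
Contains : ∀ {m n} → Graph n → Graph m → Set
Contains G H = ∃[ f ] (IsHom H G f × Injective _≡_ _≡_ f)

Free : ∀ {m n} → Graph m → Graph n → Set
Free H G = ¬ Contains G H

Colouring : ∀ {n} → ℕ → Graph n → Set
Colouring {n} k G = Σ (Fin n → Fin k) λ c → ∀ i j → Adj G i j → c i ≢ c j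

infix 4 _⊆ᴱ_

_⊆ᴱ_ : ∀ {n} → Graph n → Graph n → Set
G ⊆ᴱ G′ = ∀ i j → Adj G i j → Adj G′ i j

fromDec : ∀ {n} {R : Rel (Fin n) 0ℓ} → Decidable₂ R →
          (∀ {i j} → R i j → R j i) → (∀ {i} → ¬ R i i) → Graph n
fromDec R? R-sym R-irrefl = record
  { adj        = λ i j → ⌊ R? i j ⌋
  ; adj-sym    = fromWitness ∘ R-sym ∘ toWitness
  ; adj-irrefl = R-irrefl ∘ toWitness
  }

infixl 6 _─_

_─_ : ∀ {n} → Graph n → Graph n → Graph n
G ─ D = fromDec (λ i j → T? (adj G i j) ×-dec ¬? (T? (adj D i j)))
                (λ (g , ¬d) → adj-sym G g , ¬d ∘ adj-sym D)
                (λ (g , _) → adj-irrefl G g)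

IsMinimum : Pred ℕ 0ℓ → ℕ → Set
IsMinimum P m = P m × (∀ j → P j → m ≤ j)

IsMaximum : Pred ℕ 0ℓ → ℕ → Set
IsMaximum P m = P m × (∀ j → P j → j ≤ m)

IsMaximumOr0 : Pred ℕ 0ℓ → ℕ → Set
IsMaximumOr0 P m = IsMaximum P m ⊎ ((∀ j → ¬ P j) × m ≡ 0)

-- The set of deleted edges is encoded as a graph D on the vertex set of G.
DeletableTo : ∀ {n} → Graph n → ℕ → Pred ℕ 0ℓ
DeletableTo {n} G k d =
  Σ (Graph n) λ D → D ⊆ᴱ G × #edges D ≡ d × Colouring k (G ─ D)

minimum-exists : ∀ {P : Pred ℕ 0ℓ} → Decidable P → ∃ P → ∃ (IsMinimum P)
minimum-exists {P} P? (b , Pb) with search (suc b)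
  where
  search : ∀ n → ∃ (IsMinimum P) ⊎ (∀ j → j < n → ¬ P j)
  search zero = inj₂ λ _ ()
  search (suc n) with search n
  ... | inj₁ found = inj₁ found
  ... | inj₂ none with P? n
  ...   | yes Pn = inj₁ (n , Pn , λ j Pj → ℕ.≮⇒≥ λ j<n → none j j<n Pj)
  ...   | no ¬Pn = inj₂ λ j j<1+n Pj →
    [ (λ j<n → none j j<n Pj) , (λ { refl → ¬Pn Pj }) ]
      (ℕ.m≤n⇒m<n∨m≡n (s≤s⁻¹ j<1+n))
... | inj₁ found = found
... | inj₂ none  = contradiction Pb (none b ℕ.≤-refl)

maximum-exists : ∀ {P : Pred ℕ 0ℓ} → Decidable P →
                 ∀ b → (∀ j → P j → j ≤ b) → ∃ (IsMaximumOr0 P)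
maximum-exists P? b bound with P? b
... | yes Pb = b , inj₁ (Pb , bound)
maximum-exists {P} P? zero bound | no ¬P0 =
  0 , inj₂ ((λ j Pj → ¬P0 (subst P (ℕ.n≤0⇒n≡0 (bound j Pj)) Pj)) , refl)
maximum-exists {P} P? (suc b) bound | no ¬Pb =
  maximum-exists P? b λ j Pj →
    s≤s⁻¹
      (ℕ.≤∧≢⇒< (bound j Pj) λ j≡ → ¬Pb (subst P j≡ Pj))

-- Without function extensionality, functions Fin m → Fin n and hence graphs
-- are enumerated only up to pointwise equality.

any-fun? : ∀ {m n} {P : Pred (Fin m → Fin n) 0ℓ} →
           (∀ {f g} → (∀ i → f i ≡ g i) → P f → P g) →
           Decidable P → Dec (∃ P)
any-fun? {P = P} resp P? =
  map′ (λ (c , p) → finToFun c , p)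
       (λ (f , p) → funToFin f , resp (λ i → sym (finToFun-funToFin f i)) p)
       (any? (P? ∘ finToFun))

infix 4 _≈ᴱ_

_≈ᴱ_ : ∀ {n} → Graph n → Graph n → Set
G ≈ᴱ G′ = G ⊆ᴱ G′ × G′ ⊆ᴱ G

≈ᴱ-sym : ∀ {n} {G G′ : Graph n} → G ≈ᴱ G′ → G′ ≈ᴱ G
≈ᴱ-sym (p , q) = q , p

module _ {n : ℕ} where

  private
    R : (Fin n → Fin (2 ^ n)) → Rel (Fin n) 0ℓ
    R f i j = i ≢ j × finToFun (f i) j ≡ suc zero × finToFun (f j) i ≡ suc zero

    decode : (Fin n → Fin (2 ^ n)) → Graph n
    decode f = fromDec {R = R f}
      (λ i j → ¬? (i ≟ j) ×-dec (finToFun (f i) j ≟ suc zero)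
                          ×-dec (finToFun (f j) i ≟ suc zero))
      (λ (i≢j , p , q) → i≢j ∘ sym , q , p)
      (λ (i≢i , _) → i≢i refl)

    decode-cong : ∀ {f g} → (∀ i → f i ≡ g i) → decode f ≈ᴱ decode g
    decode-cong eq = half eq , half (sym ∘ eq)
      where
      half : ∀ {f g} → (∀ i → f i ≡ g i) → decode f ⊆ᴱ decode g
      half eq i j a with toWitness a
      ... | i≢j , p , q = fromWitness
        ( i≢j
        , subst (λ x → finToFun x j ≡ suc zero) (eq i) p
        , subst (λ x → finToFun x i ≡ suc zero) (eq j) q)

    bit : ∀ {A : Set} → Dec A → Fin 2
    bit (yes _) = suc zero
    bit (no _)  = zero

    bit⁺ : ∀ {A : Set} (d : Dec A) → A → bit d ≡ suc zero
    bit⁺ (yes _) _ = refl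
    bit⁺ (no ¬a) a = contradiction a ¬a

    bit⁻ : ∀ {A : Set} (d : Dec A) → bit d ≡ suc zero → A
    bit⁻ (yes a) _ = a

    row : Graph n → Fin n → Fin n → Fin 2
    row G i j = bit (T? (adj G i j))

    encode : Graph n → Fin n → Fin (2 ^ n)
    encode G i = funToFin (row G i)

    decode-encode : ∀ G → G ≈ᴱ decode (encode G)
    decode-encode G =
      (λ i j a → fromWitness
        ( (λ { refl → adj-irrefl G a })
        , trans (finToFun-funToFin (row G i) j) (bit⁺ (T? _) a)
        , trans (finToFun-funToFin (row G j) i) (bit⁺ (T? _) (adj-sym G a)))) ,
      (λ i j a → bit⁻ (T? _)
        (trans (sym (finToFun-funToFin (row G i) j))
               (proj₁ (proj₂ (toWitness a)))))

  any-graph? : {P : Pred (Graph n) 0ℓ} →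
               (∀ {G G′} → G ≈ᴱ G′ → P G → P G′) →
               Decidable P → Dec (∃ P)
  any-graph? resp P? =
    map′ (λ (f , p) → decode f , p)
         (λ (G , p) → encode G , resp (decode-encode G) p)
         (any-fun? (resp ∘ decode-cong) (P? ∘ decode))

contains? : ∀ {m n} (G : Graph n) (H : Graph m) → Dec (Contains G H)
contains? G H = any-fun? resp λ f →
  all? (λ i → all? λ j → T? (adj H i j) →-dec T? (adj G (f i) (f j)))
  ×-dec
  map′ (λ inj {i} {j} → inj i j) (λ inj i j → inj)
       (all? λ i → all? λ j → (f i ≟ f j) →-dec (i ≟ j))
  where
  resp : ∀ {f g} → (∀ i → f i ≡ g i) →
         IsHom H G f × Injective _≡_ _≡_ f → IsHom H G g × Injective _≡_ _≡_ g
  resp eq (hom , inj) =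
    (λ i j a → subst₂ (Adj G) (eq i) (eq j) (hom i j a)) ,
    (λ {i} {j} gi≡gj → inj (trans (eq i) (trans gi≡gj (sym (eq j)))))

colouring? : ∀ {n} k (G : Graph n) → Dec (Colouring k G)
colouring? k G = any-fun?
  (λ eq ok i j a ci≡cj → ok i j a (trans (eq i) (trans ci≡cj (sym (eq j)))))
  (λ c → all? λ i → all? λ j → T? (adj G i j) →-dec ¬? (c i ≟ c j))

⊆ᴱ? : ∀ {n} (G G′ : Graph n) → Dec (G ⊆ᴱ G′)
⊆ᴱ? G G′ = all? λ i → all? λ j → T? (adj G i j) →-dec T? (adj G′ i j)

#edges-cong : ∀ {n} {G G′ : Graph n} → G ≈ᴱ G′ → #edges G ≡ #edges G′
#edges-cong {n} {G} {G′} (p , q) = cong length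
  (filter-≐ _ _
    ((λ (i<j , a) → i<j , p _ _ a) , (λ (i<j , a) → i<j , q _ _ a))
    (cartesianProduct (allFin n) (allFin n)))

Colouring-⊆ᴱ : ∀ {n k} {G G′ : Graph n} → G′ ⊆ᴱ G → Colouring k G → Colouring k G′
Colouring-⊆ᴱ sub (c , ok) = c , λ i j a → ok i j (sub i j a)

─-mono : ∀ {n} {G G′ D D′ : Graph n} → G ⊆ᴱ G′ → D′ ⊆ᴱ D → (G ─ D) ⊆ᴱ (G′ ─ D′)
─-mono p q i j a with toWitness a
... | g , ¬d = fromWitness (p i j g , ¬d ∘ q i j)

deletableTo? : ∀ {n} (G : Graph n) k → Decidable (DeletableTo G k)
deletableTo? G k d = any-graph?
  (λ {D} {D′} D≈D′ (D⊆G , #D , col) →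
    (λ i j a → D⊆G i j (proj₂ D≈D′ i j a)) ,
    trans (sym (#edges-cong {G = D} {D′} D≈D′)) #D ,
    Colouring-⊆ᴱ {G = G ─ D} {G ─ D′}
      (─-mono {G = G} {G} {D′} {D} (λ _ _ a → a) (proj₁ D≈D′)) col)
  (λ D → ⊆ᴱ? D G ×-dec (#edges D ℕ.≟ d) ×-dec colouring? k (G ─ D))

deletable-all : ∀ {n} (G : Graph n) k .{{_ : NonZero k}} → DeletableTo G k (#edges G)
deletable-all G k =
  G , (λ _ _ a → a) , refl , (λ _ → fromℕ< (>-nonZero⁻¹ k)) ,
  (λ i j a _ → proj₂ (toWitness a) (proj₁ (toWitness a)))

DeletableTo-cong : ∀ {n k d} {G G′ : Graph n} → G ≈ᴱ G′ →
                   DeletableTo G k d → DeletableTo G′ k d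
DeletableTo-cong {G = G} {G′} (p , q) (D , D⊆G , #D , col) =
  D , (λ i j a → p i j (D⊆G i j a)) , #D ,
  Colouring-⊆ᴱ {G = G ─ D} {G′ ─ D} (─-mono {G = G′} {G} {D} {D} q (λ _ _ a → a)) col

-- hᴳ G k is h(G,k) and h n k H is h(n,k,H).  Each is determined by the type
-- of its existence lemma, since minima and maxima are unique; hence the
-- lemmas are abstract.

abstract

  hᴳ-exists : ∀ {n} (G : Graph n) k .{{_ : NonZero k}} → ∃ (IsMinimum (DeletableTo G k))
  hᴳ-exists G k = minimum-exists (deletableTo? G k) (#edges G , deletable-all G k)

hᴳ : ∀ {n} (G : Graph n) (k : ℕ) .{{_ : NonZero k}} → ℕ
hᴳ G k = proj₁ (hᴳ-exists G k)

HValue : ∀ {p} (n k : ℕ) .{{_ : NonZero k}} → Graph p → Pred ℕ 0ℓ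
HValue n k H v = Σ (Graph n) λ G → Free H G × hᴳ G k ≡ v

#edges-bound : ∀ {n} (G : Graph n) →
               #edges G ≤ length (cartesianProduct (allFin n) (allFin n))
#edges-bound {n} G =
  length-filter (λ (i , j) → (i <? j) ×-dec T? (adj G i j))
                (cartesianProduct (allFin n) (allFin n))

hᴳ-≤ : ∀ {n} (G : Graph n) k .{{_ : NonZero k}} → ∀ {d} → DeletableTo G k d → hᴳ G k ≤ d
hᴳ-≤ G k = proj₂ (proj₂ (hᴳ-exists G k)) _

hᴳ-mono : ∀ {n} (G G′ : Graph n) k .{{_ : NonZero k}} → G ≈ᴱ G′ → hᴳ G k ≤ hᴳ G′ k
hᴳ-mono G G′ k e = hᴳ-≤ G k
  (DeletableTo-cong {G = G′} {G} (≈ᴱ-sym {G = G} {G′} e)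
    (proj₁ (proj₂ (hᴳ-exists G′ k))))

hᴳ-cong : ∀ {n} (G G′ : Graph n) k .{{_ : NonZero k}} → G ≈ᴱ G′ → hᴳ G k ≡ hᴳ G′ k
hᴳ-cong G G′ k e =
  ℕ.≤-antisym (hᴳ-mono G G′ k e) (hᴳ-mono G′ G k (≈ᴱ-sym {G = G} {G′} e))

HValue-bound : ∀ {p} n k .{{_ : NonZero k}} (H : Graph p) v → HValue n k H v →
               v ≤ length (cartesianProduct (allFin n) (allFin n))
HValue-bound n k H v (G , _ , eq) = subst (_≤ _) eq
  (ℕ.≤-trans (hᴳ-≤ G k (deletable-all G k)) (#edges-bound G))

hValue? : ∀ {p} n k .{{_ : NonZero k}} (H : Graph p) → Decidable (HValue n k H)
hValue? n k H v = any-graph?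
  (λ {G} {G′} (G⊆G′ , G′⊆G) (free , eq) →
    (λ (f , hom , inj) → free (f , (λ i j a → G′⊆G _ _ (hom i j a)) , inj)) ,
    trans (sym (hᴳ-cong G G′ k (G⊆G′ , G′⊆G))) eq)
  (λ G → ¬? (contains? G H) ×-dec (hᴳ G k ℕ.≟ v))

abstract

  h-exists : ∀ {p} (n k : ℕ) .{{_ : NonZero k}} (H : Graph p) →
             ∃ (IsMaximumOr0 (HValue n k H))
  h-exists n k H = maximum-exists (hValue? n k H) _ (HValue-bound n k H)

h : ∀ {p} (n k : ℕ) .{{_ : NonZero k}} → Graph p → ℕ
h n k H = proj₁ (h-exists n k H)

infix 4 _∈o_

_∈o_ : (ℕ → ℕ) → (ℕ → ℕ) → Set
e ∈o g = ∀ (ε : ℚ) → 0ℚ ℚ.< ε →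
         ∃[ N ] (∀ n → n ≥ N → (+ e n / 1) ℚ.≤ ε ℚ.* (+ g n / 1))

{-# OPTIONS --safe #-}

-- Call a pair (P , Q) of vertex sets regular if e(X , Y) > |X||Y| / d for all
-- X ⊆ P and Y ⊆ Q with |P| ≤ r|X| and |Q| ≤ r|Y|.  If the vertices of H carry large sets,
-- regular along the edges of H, then H embeds greedily.  Since H maps homomorphically
-- to H′, it suffices to delete o(n²) edges from an H-free graph so that every remaining
-- edge lies in a regular pair of large classes of a bounded partition: a surviving
-- copy of H′ would then yield a copy of H.
--
-- As regularity is one-sided, no quadratic energy is needed.  As long as the non-regular
-- pairs having an edge cover a positive proportion of V × V, delete the few edges
-- between their witnesses X and Y and refine the partition by all X and Y.  The area of
-- the class pairs without edges then grows by a constant proportion of n², and each round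
-- deletes at most 2/d times the newly emptied area, so in total at most 2n²/d
-- ordered pairs are lost.

module Submission where

open import Defs
open import Algebra.Properties.Semiring.Sum using ()
open import Data.Bool.Base using (Bool; true; false; T; _∧_; _∨_; not)
open import Data.Bool.Properties using (T-∧; T-∨)
open import Data.Fin.Base using (Fin; zero; suc; combine; funToFin; finToFun)
open import Data.Fin.Properties
  using (_≟_; _<?_; any?; all?; suc-injective; combine-injective; finToFun-funToFin)
open import Data.Fin.Subset using (Subset)
open import Data.Fin.Subset.Properties using (anySubset?)
import Data.Integer.Base as ℤ
import Data.Integer.Properties as ℤ
open import Data.List.Base
  using (length; filter; cartesianProduct; tabulate; map; _++_)
open import Data.List.Properties using (filter-++; length-++; map-tabulate)
open import Data.Nat.Base
open import Data.Nat.Properties hiding (_≟_; _<?_; suc-injective)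
open import Data.Nat.Solver using (module +-*-Solver)
open import Data.Product.Base using (∃₂; ∃-syntax; _×_; _,_; proj₁; proj₂)
open import Data.Rational.Base as ℚ using (mkℚ)
import Data.Rational.Properties as ℚ
open import Data.Rational.Unnormalised.Base as ℚᵘ using (mkℚᵘ; *≤*)
import Data.Rational.Unnormalised.Properties as ℚᵘ
open import Data.Sum.Base using (_⊎_; inj₁; inj₂)
open import Data.Unit.Base using (tt)
import Data.Vec.Base as Vec
open import Data.Vec.Base using (lookup)
open import Data.Vec.Properties using (lookup∘tabulate)
open import Function.Base using (_∘_; id; flip)
open import Function.Bundles using (Equivalence)
open import Function.Definitions using (Injective)
open import Level using (0ℓ)
open import Relation.Binary.PropositionalEquality
open import Relation.Nullary using (Dec; ¬_; yes; no; contradiction)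
open import Relation.Nullary.Decidable
  using ( ⌊_⌋; does; isYes≗does; toWitness; fromWitness; toWitnessFalse
        ; T?; ¬?; _×-dec_; _→-dec_)
open import Relation.Unary using (Pred; Decidable)

open Algebra.Properties.Semiring.Sum +-*-semiring
  using (sum; sum-cong-≗; ∑-distrib-+; ∑-comm; *-distribˡ-sum; *-distribʳ-sum)

private variable
  m n p q : ℕ

-- Cardinalities of vertex sets

Set[_] : ℕ → Set
Set[ n ] = Fin n → Bool

infix 4 _⊆_

_⊆_ : Set[ n ] → Set[ n ] → Set
X ⊆ Y = ∀ v → T (X v) → T (Y v)

∧⁻ : ∀ {a b} → T (a ∧ b) → T a × T b
∧⁻ = Equivalence.to T-∧

∧⁺ : ∀ {a b} → T a → T b → T (a ∧ b)
∧⁺ x y = Equivalence.from T-∧ (x , y)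

ι : Bool → ℕ
ι false = 0
ι true  = 1

ι-mono : ∀ {a b} → (T a → T b) → ι a ≤ ι b
ι-mono {false}         _ = z≤n
ι-mono {true}  {true}  _ = ≤-refl
ι-mono {true}  {false} f = contradiction tt f

ι-*-mono : ∀ b {x y} → (T b → x ≤ y) → ι b * x ≤ ι b * y
ι-*-mono false _ = z≤n
ι-*-mono true  f = *-monoʳ-≤ 1 (f tt)

sum-mono : ∀ {f g : Fin n → ℕ} → (∀ i → f i ≤ g i) → sum f ≤ sum g
sum-mono {zero}  _ = z≤n
sum-mono {suc n} h = +-mono-≤ (h zero) (sum-mono (h ∘ suc))

sum-const : ∀ n c → sum {n} (λ _ → c) ≡ n * c
sum-const zero    c = refl
sum-const (suc n) c = cong (c +_) (sum-const n c)

summand≤sum : ∀ (f : Fin n → ℕ) i → f i ≤ sum f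
summand≤sum f zero    = m≤m+n _ _
summand≤sum f (suc i) = ≤-trans (summand≤sum (f ∘ suc) i) (m≤n+m _ (f zero))

∣_∣ : Set[ n ] → ℕ
∣ X ∣ = sum (ι ∘ X)

sum-zero : ∀ {f : Fin n → ℕ} → (∀ i → f i ≡ 0) → sum f ≡ 0
sum-zero {n} f≡0 = trans (sum-cong-≗ f≡0) (trans (sum-const n 0) (*-zeroʳ n))

sum-select : ∀ i (f : Fin n → ℕ) → sum (λ j → ι ⌊ i ≟ j ⌋ * f j) ≡ f i
sum-select {suc n} zero    f = begin
  1 * f zero + sum {n} (λ _ → 0)  ≡⟨ cong₂ _+_ (*-identityˡ (f zero)) (sum-zero {n} λ _ → refl) ⟩
  f zero + 0                      ≡⟨ +-identityʳ (f zero) ⟩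
  f zero                          ∎
  where open ≡-Reasoning
sum-select (suc i) f = trans
  -- `⌊_⌋` is stuck on a decision about successors, whereas `does` computes through it.
  (sum-cong-≗ λ j → cong (λ b → ι b * f (suc j))
    (trans (isYes≗does (suc i ≟ suc j)) (sym (isYes≗does (i ≟ j)))))
  (sum-select i (f ∘ suc))

∣∣-empty : ∀ {X : Set[ n ]} → (∀ v → ¬ T (X v)) → ∣ X ∣ ≡ 0
∣∣-empty empty = sum-zero λ v → n≤0⇒n≡0 (ι-mono (empty v))

∣singleton∣ : ∀ (i : Fin n) → ∣ (λ j → ⌊ i ≟ j ⌋) ∣ ≡ 1
∣singleton∣ i = trans (sum-cong-≗ λ j → sym (*-identityʳ (ι ⌊ i ≟ j ⌋))) (sum-select i (λ _ → 1))

-- Union bound: were every vertex of `C` in some `B y`, counting the incidences in both orders would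
-- give |C| at most the sum of the |B y|.
pick-avoiding : ∀ (C : Set[ n ]) (B : Fin p → Set[ n ]) →
                sum (λ y → ∣ B y ∣) < ∣ C ∣ →
                ∃[ v ] T (C v) × (∀ y → ¬ T (B y v))
pick-avoiding {n} {p} C B small
  with any? (λ v → T? (C v) ×-dec all? (λ y → ¬? (T? (B y v))))
... | yes found = found
... | no  none  = contradiction small (≤⇒≯ (begin
  ∣ C ∣                               ≤⟨ sum-mono covered ⟩
  sum (λ v → sum (λ y → ι (B y v)))   ≡⟨ ∑-comm (λ v y → ι (B y v)) ⟩
  sum (λ y → ∣ B y ∣)                 ∎))
  where
  open ≤-Reasoning
  covered : ∀ v → ι (C v) ≤ sum (λ y → ι (B y v))
  covered v with C v in Cv
  ... | false = z≤n
  ... | true with any? (λ y → T? (B y v))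
  ...   | no  ∄ = contradiction (v , subst T (sym Cv) tt , λ y b → ∄ (y , b)) none
  ...   | yes (y , b) = begin
    1                         ≤⟨ ι-mono {true} (λ _ → b) ⟩
    ι (B y v)                 ≤⟨ summand≤sum (λ y → ι (B y v)) y ⟩
    sum (λ y → ι (B y v))     ∎

-- The embedding lemma for regular pairs

deg : Graph n → Set[ n ] → Fin n → ℕ
deg G Y u = ∣ (λ v → Y v ∧ adj G u v) ∣

e[_] : Graph n → Set[ n ] → Set[ n ] → ℕ
e[ G ] X Y = sum λ u → ι (X u) * deg G Y u

-- The densities and relative sizes are multiplied out, with 1/d as the density and 1/r as the least
-- relative size, so that all arithmetic stays in ℕ.
Regular : Graph n → ℕ → ℕ → Set[ n ] → Set[ n ] → Set
Regular G d r P Q = ∀ X Y → X ⊆ P → Y ⊆ Q →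
  ∣ P ∣ ≤ r * ∣ X ∣ → ∣ Q ∣ ≤ r * ∣ Y ∣ → ∣ X ∣ * ∣ Y ∣ < d * e[ G ] X Y

module _ (G : Graph n) (d : ℕ) where

  open ≤-Reasoning

  -- Relative sizes multiply: a set filling 1/r′ of `P′`, which fills 1/d of `P`, fills 1/(d r′) of
  -- `P` and is therefore tested by the given regularity.
  Regular-restrict : ∀ {r r′ P P′ Q Q′} → d * r′ ≤ r → P′ ⊆ P → Q′ ⊆ Q →
    ∣ P ∣ ≤ d * ∣ P′ ∣ → ∣ Q ∣ ≤ d * ∣ Q′ ∣ →
    Regular G d r P Q → Regular G d r′ P′ Q′
  Regular-restrict {r} {r′} dr′≤r P′⊆P Q′⊆Q P≤ Q≤ reg X Y X⊆ Y⊆ X≥ Y≥ =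
    reg X Y (λ v → P′⊆P v ∘ X⊆ v) (λ v → Q′⊆Q v ∘ Y⊆ v) (large P≤ X≥) (large Q≤ Y≥)
    where
    large : ∀ {a b c} → a ≤ d * b → b ≤ r′ * c → a ≤ r * c
    large {a} {b} {c} a≤ b≤ = begin
      a             ≤⟨ a≤ ⟩
      d * b         ≤⟨ *-monoʳ-≤ d b≤ ⟩
      d * (r′ * c)  ≡⟨ *-assoc d r′ c ⟨
      d * r′ * c    ≤⟨ *-monoˡ-≤ c dr′≤r ⟩
      r * c         ∎

  -- If |X| exceeded |P|/r, regularity would apply to `X` and the whole of `Q`; but degrees of at
  -- most |Q|/d add up to no more than |X||Q|/d edges.
  few-low-degrees : ∀ {r P Q} .{{_ : NonZero r}} → Regular G d r P Q →
    ∀ X → X ⊆ P → (∀ u → T (X u) → d * deg G Q u ≤ ∣ Q ∣) → r * ∣ X ∣ ≤ ∣ P ∣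
  few-low-degrees {r} {P} {Q} reg X X⊆P low = ≮⇒≥ λ P<rX →
    <⇒≱ (reg X Q X⊆P (λ _ → id) (<⇒≤ P<rX) (m≤n*m ∣ Q ∣ r)) (begin
      d * e[ G ] X Q                         ≡⟨ *-distribˡ-sum d (λ u → ι (X u) * deg G Q u) ⟩
      sum (λ u → d * (ι (X u) * deg G Q u))  ≡⟨ sum-cong-≗ (λ u → swap* d (ι (X u)) (deg G Q u)) ⟩
      sum (λ u → ι (X u) * (d * deg G Q u))  ≤⟨ sum-mono (λ u → ι-*-mono (X u) (low u)) ⟩
      sum (λ u → ι (X u) * ∣ Q ∣)            ≡⟨ *-distribʳ-sum ∣ Q ∣ (ι ∘ X) ⟨
      ∣ X ∣ * ∣ Q ∣                          ∎)
    where
    swap* : ∀ a b c → a * (b * c) ≡ b * (a * c)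
    swap* a b c = trans (sym (*-assoc a b c)) (trans (cong (_* c) (*-comm a b)) (*-assoc b a c))

tail : Graph (suc p) → Graph p
tail H = record
  { adj        = λ i j → adj H (suc i) (suc j)
  ; adj-sym    = adj-sym H
  ; adj-irrefl = adj-irrefl H
  }

-- Each embedded vertex costs the remaining candidate sets a factor `d`. The factor 2 allows a set
-- to lose one vertex and still keep half of its size.
minSize : ℕ → ℕ → ℕ
minSize d p = 2 * d ^ p

-- The power of `d` pays for the shrinking of the candidate sets; the factor p + 1 keeps the value
-- above the number of low-degree sets in the union bound.
minReg : ℕ → ℕ → ℕ
minReg d p = suc p * d ^ p

module _ (G : Graph n) {d : ℕ} (2≤d : 2 ≤ d) where

  open ≤-Reasoning

  private
    instance
      d≢0 : NonZero d
      d≢0 = >-nonZero (≤-trans (s≤s z≤n) 2≤d)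

    -- The candidates left in `Y` once `u` is chosen; the flag tells whether the two vertices of H
    -- are adjacent. In both cases `u` itself drops out, which yields injectivity.
    keep : Bool → Fin n → Set[ n ] → Set[ n ]
    keep true  u Y v = Y v ∧ adj G u v
    keep false u Y v = Y v ∧ not ⌊ u ≟ v ⌋

    keep⊆ : ∀ b u Y → keep b u Y ⊆ Y
    keep⊆ true  u Y v = proj₁ ∘ ∧⁻
    keep⊆ false u Y v = proj₁ ∘ ∧⁻

    keep-fresh : ∀ b u Y {v} → T (keep b u Y v) → u ≢ v
    keep-fresh true  u Y t refl = adj-irrefl G (proj₂ (∧⁻ {Y u} t))
    keep-fresh false u Y {v} t  = toWitnessFalse (proj₂ (∧⁻ {Y v} t))

    keep-adj : ∀ {b} u Y {v} → T b → T (keep b u Y v) → Adj G u v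
    keep-adj {true} u Y {v} _ t = proj₂ (∧⁻ {Y v} t)

    ∣delete∣ : ∀ u Y → ∣ Y ∣ ≤ ∣ keep false u Y ∣ + 1
    ∣delete∣ u Y = begin
      ∣ Y ∣  ≤⟨ sum-mono split ⟩
      sum (λ v → ι (keep false u Y v) + ι ⌊ u ≟ v ⌋)
        ≡⟨ ∑-distrib-+ (ι ∘ keep false u Y) (λ v → ι ⌊ u ≟ v ⌋) ⟩
      ∣ keep false u Y ∣ + ∣ (λ v → ⌊ u ≟ v ⌋) ∣  ≡⟨ cong (∣ keep false u Y ∣ +_) (∣singleton∣ u) ⟩
      ∣ keep false u Y ∣ + 1 ∎
      where
      split : ∀ v → ι (Y v) ≤ ι (keep false u Y v) + ι ⌊ u ≟ v ⌋
      split v with Y v | ⌊ u ≟ v ⌋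
      ... | false | _     = z≤n
      ... | true  | true  = ≤-refl
      ... | true  | false = ≤-refl

    keep-large : ∀ b u Y → 2 ≤ ∣ Y ∣ → (T b → ∣ Y ∣ ≤ d * deg G Y u) →
                 ∣ Y ∣ ≤ d * ∣ keep b u Y ∣
    keep-large true  u Y _   high = high tt
    keep-large false u Y 2≤Y _    = begin
      ∣ Y ∣      ≤⟨ Y≤ ⟩
      k + 1      ≤⟨ +-monoʳ-≤ k (+-cancelʳ-≤ 1 1 k (≤-trans 2≤Y Y≤)) ⟩
      k + k      ≡⟨ cong (k +_) (+-identityʳ k) ⟨
      2 * k      ≤⟨ *-monoˡ-≤ k 2≤d ⟩
      d * k      ∎
      where
      k  = ∣ keep false u Y ∣
      Y≤ = ∣delete∣ u Y

  -- Induction on the vertices of H. The vertex `zero` goes to some `v₀` having many neighbours in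
  -- the set of each neighbour of `zero`; the other sets are then cut down by `keep`, lose at most a
  -- factor `d`, and stay regular with the next smaller constant.
  embed : ∀ {p} (H : Graph p) (C : Fin p → Set[ n ]) →
    (∀ x → minSize d p ≤ ∣ C x ∣) →
    (∀ x y → Adj H x y → Regular G d (minReg d p) (C x) (C y)) →
    ∃[ f ] (∀ x → T (C x (f x))) × IsHom H G f × Injective _≡_ _≡_ f
  embed {zero}  H C large reg = (λ ()) , (λ ()) , (λ ()) , λ {}
  embed {suc p} H C large reg = f , f∈C , f-hom , f-inj
    where
    C₀ = C zero
    C₊ = C ∘ suc
    r  = minReg d (suc p)

    instance
      dᵖ⁺¹≢0 : NonZero (d ^ suc p)
      dᵖ⁺¹≢0 = m^n≢0 d (suc p)

      r≢0 : NonZero r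
      r≢0 = m*n≢0 (2 + p) (d ^ suc p)

    2≤∣C∣ : ∀ x → 2 ≤ ∣ C x ∣
    2≤∣C∣ x = ≤-trans (m≤m*n 2 (d ^ suc p)) (large x)

    low : Fin p → Set[ n ]
    low y v = C₀ v ∧ (adj H zero (suc y) ∧ (d * deg G (C₊ y) v ≤ᵇ ∣ C₊ y ∣))

    low-few : ∀ y → r * ∣ low y ∣ ≤ ∣ C₀ ∣
    low-few y with adj H zero (suc y) in 0~y
    ... | true  = few-low-degrees G d (reg zero (suc y) (subst T (sym 0~y) tt)) _
                    (λ v → proj₁ ∘ ∧⁻ {C₀ v})
                    (λ v → ≤ᵇ⇒≤ _ _ ∘ proj₂ ∘ ∧⁻ {C₀ v})
    ... | false = begin
      r * ∣ (λ v → C₀ v ∧ false) ∣  ≡⟨ cong (r *_) (∣∣-empty λ v → proj₂ ∘ ∧⁻ {C₀ v}) ⟩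
      r * 0                         ≡⟨ *-zeroʳ r ⟩
      0                             ≤⟨ z≤n ⟩
      ∣ C₀ ∣                        ∎

    -- There are p low sets, each of relative size at most 1/r, and p < r.
    low-total : sum (λ y → ∣ low y ∣) < ∣ C₀ ∣
    low-total = *-cancelˡ-< r _ _ (begin-strict
      r * sum (λ y → ∣ low y ∣)    ≡⟨ *-distribˡ-sum r (λ y → ∣ low y ∣) ⟩
      sum (λ y → r * ∣ low y ∣)    ≤⟨ sum-mono low-few ⟩
      sum {p} (λ y → ∣ C₀ ∣)       ≡⟨ sum-const p ∣ C₀ ∣ ⟩
      p * ∣ C₀ ∣                   <⟨ *-monoˡ-< ∣ C₀ ∣ {{>-nonZero (<⇒≤ (2≤∣C∣ zero))}} p<r ⟩
      r * ∣ C₀ ∣                   ∎)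
      where
      p<r : p < r
      p<r = ≤-trans (n≤1+n (suc p)) (m≤m*n (2 + p) (d ^ suc p))

    chosen = pick-avoiding C₀ low low-total
    v₀     = proj₁ chosen
    v₀∈C₀  = proj₁ (proj₂ chosen)

    high : ∀ y → Adj H zero (suc y) → ∣ C₊ y ∣ ≤ d * deg G (C₊ y) v₀
    high y 0~y = ≰⇒≥ λ le →
      proj₂ (proj₂ chosen) y (∧⁺ v₀∈C₀ (∧⁺ 0~y (≤⇒≤ᵇ le)))

    C′ : Fin p → Set[ n ]
    C′ y = keep (adj H zero (suc y)) v₀ (C₊ y)

    C′⊆C₊ : ∀ y → C′ y ⊆ C₊ y
    C′⊆C₊ y = keep⊆ (adj H zero (suc y)) v₀ (C₊ y)

    shrinks : ∀ y → ∣ C₊ y ∣ ≤ d * ∣ C′ y ∣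
    shrinks y = keep-large (adj H zero (suc y)) v₀ (C₊ y) (2≤∣C∣ (suc y)) (high y)

    large′ : ∀ y → minSize d p ≤ ∣ C′ y ∣
    large′ y = *-cancelˡ-≤ d (begin
      d * (2 * d ^ p)  ≡⟨ *-assoc d 2 (d ^ p) ⟨
      d * 2 * d ^ p    ≡⟨ cong (_* d ^ p) (*-comm d 2) ⟩
      2 * d * d ^ p    ≡⟨ *-assoc 2 d (d ^ p) ⟩
      2 * d ^ suc p    ≤⟨ large (suc y) ⟩
      ∣ C₊ y ∣         ≤⟨ shrinks y ⟩
      d * ∣ C′ y ∣     ∎)

    r-step : d * minReg d p ≤ r
    r-step = begin
      d * (suc p * d ^ p)  ≡⟨ *-assoc d (suc p) (d ^ p) ⟨
      d * suc p * d ^ p    ≡⟨ cong (_* d ^ p) (*-comm d (suc p)) ⟩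
      suc p * d * d ^ p    ≡⟨ *-assoc (suc p) d (d ^ p) ⟩
      suc p * d ^ suc p    ≤⟨ *-monoˡ-≤ (d ^ suc p) (n≤1+n (suc p)) ⟩
      r                    ∎

    reg′ : ∀ x y → Adj (tail H) x y → Regular G d (minReg d p) (C′ x) (C′ y)
    reg′ x y x~y = Regular-restrict G d {r} {minReg d p} r-step (C′⊆C₊ x) (C′⊆C₊ y)
                     (shrinks x) (shrinks y) (reg (suc x) (suc y) x~y)

    IH = embed (tail H) C′ large′ reg′
    g     = proj₁ IH
    g∈C′  = proj₁ (proj₂ IH)
    g-hom = proj₁ (proj₂ (proj₂ IH))
    g-inj = proj₂ (proj₂ (proj₂ IH))

    f : Fin (suc p) → Fin n
    f zero    = v₀
    f (suc y) = g y

    f∈C : ∀ x → T (C x (f x))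
    f∈C zero    = v₀∈C₀
    f∈C (suc y) = C′⊆C₊ y (g y) (g∈C′ y)

    v₀~ : ∀ y → Adj H zero (suc y) → Adj G v₀ (g y)
    v₀~ y 0~y = keep-adj v₀ (C₊ y) 0~y (g∈C′ y)

    fresh : ∀ y → v₀ ≢ g y
    fresh y = keep-fresh (adj H zero (suc y)) v₀ (C₊ y) (g∈C′ y)

    f-hom : IsHom H G f
    f-hom zero    zero    a = contradiction a (adj-irrefl H)
    f-hom zero    (suc y) a = v₀~ y a
    f-hom (suc x) zero    a = adj-sym G (v₀~ x (adj-sym H a))
    f-hom (suc x) (suc y) a = g-hom x y a

    f-inj : Injective _≡_ _≡_ f
    f-inj {zero}  {zero}  _  = refl
    f-inj {zero}  {suc y} eq = contradiction eq (fresh y)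
    f-inj {suc x} {zero}  eq = contradiction (sym eq) (fresh x)
    f-inj {suc x} {suc y} eq = cong suc (g-inj eq)

-- Areas of relations, and pruning of graphs

T-not⁺ : ∀ {a} → ¬ T a → T (not a)
T-not⁺ {false} _ = tt
T-not⁺ {true}  f = f tt

T-not⁻ : ∀ {a} → T (not a) → ¬ T a
T-not⁻ {false} _ ()

∑∑ : (Fin n → Fin n → ℕ) → ℕ
∑∑ F = sum λ u → sum λ v → F u v

∑∑-mono : ∀ {F F′ : Fin n → Fin n → ℕ} → (∀ u v → F u v ≤ F′ u v) → ∑∑ F ≤ ∑∑ F′
∑∑-mono F≤ = sum-mono λ u → sum-mono (F≤ u)

∑∑-distrib-+ : ∀ (F F′ : Fin n → Fin n → ℕ) → ∑∑ (λ u v → F u v + F′ u v) ≡ ∑∑ F + ∑∑ F′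
∑∑-distrib-+ F F′ = trans
  (sum-cong-≗ λ u → ∑-distrib-+ (F u) (F′ u))
  (∑-distrib-+ (λ u → sum (F u)) (λ u → sum (F′ u)))

*-distribˡ-∑∑ : ∀ c (F : Fin n → Fin n → ℕ) → c * ∑∑ F ≡ ∑∑ (λ u v → c * F u v)
*-distribˡ-∑∑ c F = trans
  (*-distribˡ-sum c (λ u → sum (F u)))
  (sum-cong-≗ λ u → *-distribˡ-sum c (F u))

area : (Fin n → Fin n → Bool) → ℕ
area R = ∑∑ λ u v → ι (R u v)

area≤ : ∀ (R : Fin n → Fin n → Bool) → area R ≤ n * n
area≤ {n} R = begin
  area R                  ≤⟨ ∑∑-mono (λ u v → ι-mono {R u v} {true} λ _ → tt) ⟩
  ∑∑ {n} (λ _ _ → 1)      ≡⟨ sum-cong-≗ {n} (λ _ → trans (sum-const n 1) (*-identityʳ n)) ⟩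
  sum {n} (λ _ → n)       ≡⟨ sum-const n n ⟩
  n * n                   ∎
  where open ≤-Reasoning

ι-cover : ∀ {a b c} → (T a → T b ⊎ T c) → ι a ≤ ι b + ι c
ι-cover {false}                 _ = z≤n
ι-cover {true}  {true}          _ = s≤s z≤n
ι-cover {true}  {false} {true}  _ = ≤-refl
ι-cover {true}  {false} {false} f with f tt
... | inj₁ ()
... | inj₂ ()

area-cover : ∀ {R S S′ : Fin n → Fin n → Bool} →
             (∀ u v → T (R u v) → T (S u v) ⊎ T (S′ u v)) → area R ≤ area S + area S′
area-cover {S = S} {S′} cov = ≤-trans (∑∑-mono λ u v → ι-cover (cov u v))
  (≤-reflexive (∑∑-distrib-+ (λ u v → ι (S u v)) (λ u v → ι (S′ u v))))

ι-pack : ∀ {a b c} → (T a → T c) → (T b → T c) → ¬ (T a × T b) → ι a + ι b ≤ ι c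
ι-pack {false}         _  b⇒c _    = ι-mono b⇒c
ι-pack {true}  {false} a⇒c _  _    = ι-mono a⇒c
ι-pack {true}  {true}  _   _  disj = contradiction (tt , tt) disj

area-pack : ∀ {R S U : Fin n → Fin n → Bool} →
            (∀ u v → T (R u v) → T (U u v)) → (∀ u v → T (S u v) → T (U u v)) →
            (∀ u v → ¬ (T (R u v) × T (S u v))) → area R + area S ≤ area U
area-pack {R = R} {S} R⇒U S⇒U disj = ≤-trans
  (≤-reflexive (sym (∑∑-distrib-+ (λ u v → ι (R u v)) (λ u v → ι (S u v)))))
  (∑∑-mono λ u v → ι-pack (R⇒U u v) (S⇒U u v) (disj u v))

-- Ordered pairs are counted, so every lost edge contributes 2.
loss : Graph n → Graph n → ℕ
loss G G′ = area λ u v → adj G u v ∧ not (adj G′ u v)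

loss-triangle : ∀ (G G′ G″ : Graph n) → loss G G″ ≤ loss G G′ + loss G′ G″
loss-triangle G G′ G″ = area-cover split
  where
  split : ∀ u v → T (adj G u v ∧ not (adj G″ u v)) →
          T (adj G u v ∧ not (adj G′ u v)) ⊎ T (adj G′ u v ∧ not (adj G″ u v))
  split u v t with adj G u v | adj G′ u v
  ... | true | true  = inj₂ t
  ... | true | false = inj₁ tt

-- Both (u , v) and (v , u) are tested, so that R need not be symmetric.
prune : Graph n → (Fin n → Fin n → Bool) → Graph n
prune G R = record
  { adj        = λ u v → adj G u v ∧ (not (R u v) ∧ not (R v u))
  ; adj-sym    = λ {u} {v} t → let g , t′ = ∧⁻ {adj G u v} t ; a , b = ∧⁻ {not (R u v)} t′
                               in ∧⁺ (adj-sym G g) (∧⁺ b a)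
  ; adj-irrefl = λ {u} → adj-irrefl G ∘ proj₁ ∘ ∧⁻ {adj G u u}
  }

module _ (G : Graph n) (R : Fin n → Fin n → Bool) where

  prune⊆ : prune G R ⊆ᴱ G
  prune⊆ u v = proj₁ ∘ ∧⁻ {adj G u v}

  prune-avoids : ∀ u v → Adj (prune G R) u v → ¬ T (R u v)
  prune-avoids u v t = T-not⁻ (proj₁ (∧⁻ {not (R u v)} (proj₂ (∧⁻ {adj G u v} t))))

  -- A deleted pair satisfies `R` in one of its two orders, and by symmetry of `G` both orders cover
  -- the same area.
  loss-prune : loss G (prune G R) ≤ 2 * area (λ u v → adj G u v ∧ R u v)
  loss-prune = begin
    loss G (prune G R)          ≤⟨ area-cover cov ⟩
    area S + area (flip S)      ≡⟨ cong (area S +_) (∑-comm (λ u v → ι (S v u))) ⟩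
    area S + area S             ≡⟨ cong (area S +_) (+-identityʳ (area S)) ⟨
    2 * area S                  ∎
    where
    open ≤-Reasoning
    S : Fin n → Fin n → Bool
    S u v = adj G u v ∧ R u v

    cov : ∀ u v → T (adj G u v ∧ not (adj (prune G R) u v)) → T (S u v) ⊎ T (S v u)
    cov u v t with ∧⁻ {adj G u v} t
    ... | g , ¬pruned with T? (R u v) | T? (R v u)
    ...   | yes r | _     = inj₁ (∧⁺ g r)
    ...   | no _  | yes r = inj₂ (∧⁺ (adj-sym G g) r)
    ...   | no ¬r | no ¬s = contradiction (∧⁺ g (∧⁺ (T-not⁺ ¬r) (T-not⁺ ¬s))) (T-not⁻ ¬pruned)

-- Sums over the classes of a partition

class : (Fin n → Fin m) → Fin m → Set[ n ]
class χ a v = ⌊ χ v ≟ a ⌋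

class-self : ∀ (χ : Fin n → Fin m) u → T (class χ (χ u) u)
class-self χ u = fromWitness refl

module _ (χ : Fin n → Fin m) where

  sum-by-class : ∀ (F : Fin m → Fin n → ℕ) →
                 sum (λ u → F (χ u) u) ≡ sum λ a → sum λ u → ι (class χ a u) * F a u
  sum-by-class F = trans
    (sum-cong-≗ λ u → sym (sum-select (χ u) (λ a → F a u)))
    (∑-comm (λ u a → ι (class χ a u) * F a u))

  -- `F` receives the two classes separately from the vertices; inside a block they are the
  -- constants `a` and `b`, so inequalities can be proved block by block.
  blockSum : (Fin m → Fin m → Fin n → Fin n → ℕ) → Fin m → Fin m → ℕ
  blockSum F a b = sum λ u → ι (class χ a u) * sum λ v → ι (class χ b v) * F a b u v

  ∑∑-by-blocks : ∀ F → ∑∑ (λ u v → F (χ u) (χ v) u v) ≡ sum λ a → sum λ b → blockSum F a b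
  ∑∑-by-blocks F = begin
    ∑∑ (λ u v → F (χ u) (χ v) u v)
      ≡⟨ sum-cong-≗ (λ u → sum-by-class λ b v → F (χ u) b u v) ⟩
    sum (λ u → sum λ b → inner (χ u) b u)
      ≡⟨ sum-by-class (λ a u → sum λ b → inner a b u) ⟩
    sum (λ a → sum λ u → ι (class χ a u) * sum λ b → inner a b u)
      ≡⟨ sum-cong-≗ (λ a → sum-cong-≗ λ u → *-distribˡ-sum (ι (class χ a u)) (λ b → inner a b u)) ⟩
    sum (λ a → sum λ u → sum λ b → ι (class χ a u) * inner a b u)
      ≡⟨ sum-cong-≗ (λ a → ∑-comm (λ u b → ι (class χ a u) * inner a b u)) ⟩
    sum (λ a → sum λ b → blockSum F a b)  ∎
    where
    open ≡-Reasoning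
    inner : Fin m → Fin m → Fin n → ℕ
    inner a b u = sum λ v → ι (class χ b v) * F a b u v

  ∑∑-mono-blocks : ∀ F F′ → (∀ a b → blockSum F a b ≤ blockSum F′ a b) →
                   ∑∑ (λ u v → F (χ u) (χ v) u v) ≤ ∑∑ (λ u v → F′ (χ u) (χ v) u v)
  ∑∑-mono-blocks F F′ le = begin
    ∑∑ (λ u v → F (χ u) (χ v) u v)           ≡⟨ ∑∑-by-blocks F ⟩
    sum (λ a → sum λ b → blockSum F a b)     ≤⟨ sum-mono (λ a → sum-mono (le a)) ⟩
    sum (λ a → sum λ b → blockSum F′ a b)    ≡⟨ ∑∑-by-blocks F′ ⟨
    ∑∑ (λ u v → F′ (χ u) (χ v) u v)          ∎
    where open ≤-Reasoning

rectangle : ∀ (X Y : Set[ n ]) c →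
            sum (λ u → ι (X u) * sum λ v → ι (Y v) * c) ≡ ∣ X ∣ * ∣ Y ∣ * c
rectangle X Y c = begin
  sum (λ u → ι (X u) * sum λ v → ι (Y v) * c)
    ≡⟨ sum-cong-≗ (λ u → cong (ι (X u) *_) (*-distribʳ-sum c (ι ∘ Y))) ⟨
  sum (λ u → ι (X u) * (∣ Y ∣ * c))
    ≡⟨ *-distribʳ-sum (∣ Y ∣ * c) (ι ∘ X) ⟨
  ∣ X ∣ * (∣ Y ∣ * c)
    ≡⟨ *-assoc ∣ X ∣ ∣ Y ∣ c ⟨
  ∣ X ∣ * ∣ Y ∣ * c  ∎
  where open ≡-Reasoning

ι-∧ : ∀ a b → ι (a ∧ b) ≡ ι a * ι b
ι-∧ false b = refl
ι-∧ true  b = sym (*-identityˡ (ι b))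

ι-absorb : ∀ {a b} → (T a → T b) → ι b * ι a ≡ ι a
ι-absorb {false} {b}    _ = *-zeroʳ (ι b)
ι-absorb {true}  {true} _ = refl
ι-absorb {true}  {false} f = contradiction tt f

module _ {X Y P Q : Set[ n ]} (X⊆P : X ⊆ P) (Y⊆Q : Y ⊆ Q) where

  -- Compares a block with the witness rectangle inside it: the indicators of `P` and `Q` are
  -- absorbed by those of `X` and `Y`.
  localise : ∀ (F : Fin n → Fin n → ℕ) →
    sum (λ u → ι (P u) * sum λ v → ι (Q v) * (ι (X u ∧ Y v) * F u v)) ≡
    sum (λ u → ι (X u) * sum λ v → ι (Y v) * F u v)
  localise F = sum-cong-≗ λ u → begin
    ι (P u) * sum (λ v → ι (Q v) * (ι (X u ∧ Y v) * F u v))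
      ≡⟨ cong (ι (P u) *_) (sum-cong-≗ (λ v → inner u v)) ⟩
    ι (P u) * sum (λ v → ι (X u) * (ι (Y v) * F u v))
      ≡⟨ cong (ι (P u) *_) (*-distribˡ-sum (ι (X u)) (λ v → ι (Y v) * F u v)) ⟨
    ι (P u) * (ι (X u) * sum (λ v → ι (Y v) * F u v))
      ≡⟨ *-assoc (ι (P u)) (ι (X u)) _ ⟨
    ι (P u) * ι (X u) * sum (λ v → ι (Y v) * F u v)
      ≡⟨ cong (_* sum (λ v → ι (Y v) * F u v)) (ι-absorb (X⊆P u)) ⟩
    ι (X u) * sum (λ v → ι (Y v) * F u v)  ∎
    where
    open ≡-Reasoning
    open +-*-Solver
    inner : ∀ u v → ι (Q v) * (ι (X u ∧ Y v) * F u v) ≡ ι (X u) * (ι (Y v) * F u v)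
    inner u v = begin
      ι (Q v) * (ι (X u ∧ Y v) * F u v)
        ≡⟨ cong (λ z → ι (Q v) * (z * F u v)) (ι-∧ (X u) (Y v)) ⟩
      ι (Q v) * (ι (X u) * ι (Y v) * F u v)
        ≡⟨ solve 4 (λ q x y f → q :* (x :* y :* f) := x :* (q :* y :* f)) refl
             (ι (Q v)) (ι (X u)) (ι (Y v)) (F u v) ⟩
      ι (X u) * (ι (Q v) * ι (Y v) * F u v)
        ≡⟨ cong (λ z → ι (X u) * (z * F u v)) (ι-absorb (Y⊆Q v)) ⟩
      ι (X u) * (ι (Y v) * F u v)  ∎

∣∣-cong : ∀ {X Y : Set[ n ]} → X ≗ Y → ∣ X ∣ ≡ ∣ Y ∣
∣∣-cong X≗Y = sum-cong-≗ (cong ι ∘ X≗Y)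

e-cong : ∀ (G : Graph n) {X X′ Y Y′} → X ≗ X′ → Y ≗ Y′ → e[ G ] X Y ≡ e[ G ] X′ Y′
e-cong G X≗ Y≗ = sum-cong-≗ λ u →
  cong₂ _*_ (cong ι (X≗ u)) (∣∣-cong λ v → cong (_∧ adj G u v) (Y≗ v))

-- Irregular pairs and their witnesses

Nonempty : Graph n → Set[ n ] → Set[ n ] → Set
Nonempty G P Q = ∃₂ λ u v → T (P u) × T (Q v) × Adj G u v

nonempty? : ∀ (G : Graph n) P Q → Dec (Nonempty G P Q)
nonempty? G P Q = any? λ u → any? λ v → T? (P u) ×-dec T? (Q v) ×-dec T? (adj G u v)

module _ (G : Graph n) (d r : ℕ) (P Q : Set[ n ]) where

  -- The witnesses range over `Subset`, which can be searched exhaustively; `regular` carries the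
  -- result over to Boolean functions.
  Irregular : Set
  Irregular = ∃₂ λ (S S′ : Subset n) → let X = lookup S ; Y = lookup S′ in
    X ⊆ P × Y ⊆ Q × ∣ P ∣ ≤ r * ∣ X ∣ × ∣ Q ∣ ≤ r * ∣ Y ∣ × d * e[ G ] X Y ≤ ∣ X ∣ * ∣ Y ∣

  irregular? : Dec Irregular
  irregular? = anySubset? λ S → anySubset? λ S′ → let X = lookup S ; Y = lookup S′ in
    all? (λ v → T? (X v) →-dec T? (P v)) ×-dec all? (λ v → T? (Y v) →-dec T? (Q v)) ×-dec
    (∣ P ∣ ≤? r * ∣ X ∣) ×-dec (∣ Q ∣ ≤? r * ∣ Y ∣) ×-dec (d * e[ G ] X Y ≤? ∣ X ∣ * ∣ Y ∣)

  regular : ¬ Irregular → Regular G d r P Q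
  regular ¬irr X Y X⊆P Y⊆Q X-large Y-large = ≰⇒> λ sparse → ¬irr
    ( Vec.tabulate X , Vec.tabulate Y
    , (λ v → X⊆P v ∘ subst T (X≗ v)) , (λ v → Y⊆Q v ∘ subst T (Y≗ v))
    , subst (λ k → ∣ P ∣ ≤ r * k) (sym (∣∣-cong X≗)) X-large
    , subst (λ k → ∣ Q ∣ ≤ r * k) (sym (∣∣-cong Y≗)) Y-large
    , subst₂ _≤_ (cong (d *_) (sym (e-cong G X≗ Y≗)))
                 (sym (cong₂ _*_ (∣∣-cong X≗) (∣∣-cong Y≗))) sparse)
    where
    X≗ = lookup∘tabulate X
    Y≗ = lookup∘tabulate Y

  -- Pairs without edges are left out, as they are vacant already. This keeps the witness rectangles
  -- disjoint from the vacant area.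
  Bad : Set
  Bad = Nonempty G P Q × Irregular

  bad? : Dec Bad
  bad? = nonempty? G P Q ×-dec irregular?

module Witness (G : Graph n) (d r : ℕ) (P Q : Set[ n ]) where

  -- Pairs that are not bad get empty witnesses, so that the bounds below hold uniformly for all
  -- pairs.
  witnessˡ witnessʳ : Dec (Bad G d r P Q) → Set[ n ]
  witnessˡ (yes (_ , S , _))     = lookup S
  witnessˡ (no _)                = λ _ → false
  witnessʳ (yes (_ , _ , S′ , _)) = lookup S′
  witnessʳ (no _)                = λ _ → false

  witnessˡ⊆ : ∀ bad → witnessˡ bad ⊆ P
  witnessˡ⊆ (yes (_ , _ , _ , X⊆P , _)) = X⊆P
  witnessˡ⊆ (no _) _ ()

  witnessʳ⊆ : ∀ bad → witnessʳ bad ⊆ Q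
  witnessʳ⊆ (yes (_ , _ , _ , _ , Y⊆Q , _)) = Y⊆Q
  witnessʳ⊆ (no _) _ ()

  witnessˡ-nonempty : ∀ bad {v} → T (witnessˡ bad v) → Nonempty G P Q
  witnessˡ-nonempty (yes (ne , _)) _ = ne
  witnessˡ-nonempty (no _) ()

  witness-sparse : ∀ bad →
    d * e[ G ] (witnessˡ bad) (witnessʳ bad) ≤ ∣ witnessˡ bad ∣ * ∣ witnessʳ bad ∣
  witness-sparse (yes (_ , _ , _ , _ , _ , _ , _ , sparse)) = sparse
  witness-sparse (no _) =
    ≤-trans (≤-reflexive (trans (cong (d *_) (sum-zero {n} λ _ → refl)) (*-zeroʳ d))) z≤n

  witness-large : ∀ bad → ∣ P ∣ * ∣ Q ∣ * ι ⌊ bad ⌋ ≤ ∣ witnessˡ bad ∣ * ∣ witnessʳ bad ∣ * (r * r)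
  witness-large (yes (_ , S , S′ , _ , _ , P≤ , Q≤ , _)) = begin
    ∣ P ∣ * ∣ Q ∣ * 1    ≡⟨ *-identityʳ _ ⟩
    ∣ P ∣ * ∣ Q ∣        ≤⟨ *-mono-≤ P≤ Q≤ ⟩
    r * x * (r * y)      ≡⟨ solve 3 (λ r x y → r :* x :* (r :* y) := x :* y :* (r :* r))
                                 refl r x y ⟩
    x * y * (r * r)      ∎
    where
    open ≤-Reasoning
    open +-*-Solver
    x = ∣ lookup S ∣
    y = ∣ lookup S′ ∣
  witness-large (no _) = ≤-trans (≤-reflexive (*-zeroʳ (∣ P ∣ * ∣ Q ∣))) z≤n

-- The partition into regular and vacant pairs

-- A refined class records the old class and two m × m tables of bits: membership in the left and in
-- the right witness of every pair of classes.
refinedSize : ℕ → ℕ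
refinedSize m = m * ((2 ^ m) ^ m * (2 ^ m) ^ m)

bit : Bool → Fin 2
bit false = zero
bit true  = suc zero

bit-injective : ∀ {a b} → bit a ≡ bit b → a ≡ b
bit-injective {false} {false} _ = refl
bit-injective {true}  {true}  _ = refl

tableCode : (Fin m → Fin m → Bool) → Fin ((2 ^ m) ^ m)
tableCode X = funToFin λ a → funToFin λ b → bit (X a b)

funToFin-injective : ∀ {k l} (f g : Fin k → Fin l) → funToFin f ≡ funToFin g → f ≗ g
funToFin-injective f g eq i = begin
  f i                      ≡⟨ finToFun-funToFin f i ⟨
  finToFun (funToFin f) i  ≡⟨ cong (λ c → finToFun c i) eq ⟩
  finToFun (funToFin g) i  ≡⟨ finToFun-funToFin g i ⟩
  g i                      ∎
  where open ≡-Reasoning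

tableCode-injective : ∀ {X Y : Fin m → Fin m → Bool} →
                      tableCode X ≡ tableCode Y → ∀ a b → X a b ≡ Y a b
tableCode-injective {X = X} {Y} eq a b = bit-injective
  (funToFin-injective (bit ∘ X a) (bit ∘ Y a) (funToFin-injective _ _ eq a) b)

-- A relation on vertices instead of classes, so that its area weighs each pair of classes by the
-- product of their sizes.
vacant : ∀ {m} → Graph n → (Fin n → Fin m) → Fin n → Fin n → Bool
vacant G χ u v = not ⌊ nonempty? G (class χ (χ u)) (class χ (χ v)) ⌋

module Refinement (G : Graph n) (χ : Fin n → Fin m) (d r : ℕ) where

  open ≤-Reasoning

  badClasses? : ∀ a b → Dec (Bad G d r (class χ a) (class χ b))
  badClasses? a b = bad? G d r (class χ a) (class χ b)

  badPair : Fin n → Fin n → Bool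
  badPair u v = ⌊ badClasses? (χ u) (χ v) ⌋

  private module W a b = Witness G d r (class χ a) (class χ b)

  X Y : Fin m → Fin m → Set[ n ]
  X a b = W.witnessˡ a b (badClasses? a b)
  Y a b = W.witnessʳ a b (badClasses? a b)

  X⊆ : ∀ a b → X a b ⊆ class χ a
  X⊆ a b = W.witnessˡ⊆ a b (badClasses? a b)

  Y⊆ : ∀ a b → Y a b ⊆ class χ b
  Y⊆ a b = W.witnessʳ⊆ a b (badClasses? a b)

  -- The union of all rectangles `X a b` × `Y a b`. They lie in different blocks, so their areas add
  -- up.
  Z : Fin n → Fin n → Bool
  Z u v = X (χ u) (χ v) u ∧ Y (χ u) (χ v) v

  -- In each bad block both witnesses have relative size at least 1/r, so their rectangle fills at
  -- least 1/r² of the block.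
  badArea≤ : area badPair ≤ r * r * area Z
  badArea≤ = begin
    area badPair
      ≤⟨ ∑∑-mono-blocks χ (λ a b _ _ → ι ⌊ badClasses? a b ⌋)
           (λ a b u v → ι (X a b u ∧ Y a b v) * (r * r)) block ⟩
    ∑∑ (λ u v → ι (Z u v) * (r * r))
      ≡⟨ sum-cong-≗ (λ u → sum-cong-≗ λ v → *-comm (ι (Z u v)) (r * r)) ⟩
    ∑∑ (λ u v → r * r * ι (Z u v))
      ≡⟨ *-distribˡ-∑∑ (r * r) (λ u v → ι (Z u v)) ⟨
    r * r * area Z  ∎
    where
    block : ∀ a b → blockSum χ (λ a b _ _ → ι ⌊ badClasses? a b ⌋) a b ≤
                    blockSum χ (λ a b u v → ι (X a b u ∧ Y a b v) * (r * r)) a b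
    block a b = begin
      blockSum χ (λ a b _ _ → ι ⌊ badClasses? a b ⌋) a b
        ≡⟨ rectangle (class χ a) (class χ b) (ι ⌊ badClasses? a b ⌋) ⟩
      ∣ class χ a ∣ * ∣ class χ b ∣ * ι ⌊ badClasses? a b ⌋
        ≤⟨ W.witness-large a b (badClasses? a b) ⟩
      ∣ X a b ∣ * ∣ Y a b ∣ * (r * r)
        ≡⟨ rectangle (X a b) (Y a b) (r * r) ⟨
      sum (λ u → ι (X a b u) * sum λ v → ι (Y a b v) * (r * r))
        ≡⟨ localise {X = X a b} {Y a b} (X⊆ a b) (Y⊆ a b) (λ _ _ → r * r) ⟨
      blockSum χ (λ a b u v → ι (X a b u ∧ Y a b v) * (r * r)) a b  ∎

  -- Each witness rectangle has density at most 1/d, and the blocks are summed.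
  Z-sparse : d * area (λ u v → adj G u v ∧ Z u v) ≤ area Z
  Z-sparse = begin
    d * area (λ u v → adj G u v ∧ Z u v)
      ≡⟨ *-distribˡ-∑∑ d (λ u v → ι (adj G u v ∧ Z u v)) ⟩
    ∑∑ (λ u v → d * ι (adj G u v ∧ Z u v))
      ≡⟨ sum-cong-≗ (λ u → sum-cong-≗ λ v → rearrange u v) ⟩
    ∑∑ (λ u v → ι (Z u v) * (d * ι (adj G u v)))
      ≤⟨ ∑∑-mono-blocks χ (λ a b u v → ι (X a b u ∧ Y a b v) * (d * ι (adj G u v)))
           (λ a b u v → ι (X a b u ∧ Y a b v) * 1) block ⟩
    ∑∑ (λ u v → ι (Z u v) * 1)
      ≡⟨ sum-cong-≗ (λ u → sum-cong-≗ λ v → *-identityʳ (ι (Z u v))) ⟩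
    area Z  ∎
    where
    open +-*-Solver
    rearrange : ∀ u v → d * ι (adj G u v ∧ Z u v) ≡ ι (Z u v) * (d * ι (adj G u v))
    rearrange u v = trans (cong (d *_) (ι-∧ (adj G u v) (Z u v)))
      (solve 3 (λ d g z → d :* (g :* z) := z :* (d :* g)) refl d (ι (adj G u v)) (ι (Z u v)))

    edges : ∀ A B → sum (λ u → ι (A u) * sum λ v → ι (B v) * (d * ι (adj G u v))) ≡ d * e[ G ] A B
    edges A B = begin-equality
      sum (λ u → ι (A u) * sum λ v → ι (B v) * (d * ι (adj G u v)))
        ≡⟨ sum-cong-≗ (λ u → cong (ι (A u) *_) (trans (sum-cong-≗ λ v → inner u v)
             (sym (*-distribˡ-sum d (λ v → ι (B v ∧ adj G u v)))))) ⟩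
      sum (λ u → ι (A u) * (d * deg G B u))
        ≡⟨ sum-cong-≗ (λ u → solve 3 (λ a d g → a :* (d :* g) := d :* (a :* g)) refl
             (ι (A u)) d (deg G B u)) ⟩
      sum (λ u → d * (ι (A u) * deg G B u))
        ≡⟨ *-distribˡ-sum d (λ u → ι (A u) * deg G B u) ⟨
      d * e[ G ] A B  ∎
      where
      inner : ∀ u v → ι (B v) * (d * ι (adj G u v)) ≡ d * ι (B v ∧ adj G u v)
      inner u v = trans
        (solve 3 (λ b d g → b :* (d :* g) := d :* (b :* g)) refl (ι (B v)) d (ι (adj G u v)))
        (cong (d *_) (sym (ι-∧ (B v) (adj G u v))))

    block : ∀ a b → blockSum χ (λ a b u v → ι (X a b u ∧ Y a b v) * (d * ι (adj G u v))) a b ≤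
                    blockSum χ (λ a b u v → ι (X a b u ∧ Y a b v) * 1) a b
    block a b = begin
      blockSum χ (λ a b u v → ι (X a b u ∧ Y a b v) * (d * ι (adj G u v))) a b
        ≡⟨ localise {X = X a b} {Y a b} (X⊆ a b) (Y⊆ a b) (λ u v → d * ι (adj G u v)) ⟩
      sum (λ u → ι (X a b u) * sum λ v → ι (Y a b v) * (d * ι (adj G u v)))
        ≡⟨ edges (X a b) (Y a b) ⟩
      d * e[ G ] (X a b) (Y a b)
        ≤⟨ W.witness-sparse a b (badClasses? a b) ⟩
      ∣ X a b ∣ * ∣ Y a b ∣
        ≡⟨ *-identityʳ _ ⟨
      ∣ X a b ∣ * ∣ Y a b ∣ * 1
        ≡⟨ rectangle (X a b) (Y a b) 1 ⟨
      sum (λ u → ι (X a b u) * sum λ v → ι (Y a b v) * 1)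
        ≡⟨ localise {X = X a b} {Y a b} (X⊆ a b) (Y⊆ a b) (λ _ _ → 1) ⟨
      blockSum χ (λ a b u v → ι (X a b u ∧ Y a b v) * 1) a b  ∎

  G⁺ : Graph n
  G⁺ = prune G Z

  χ⁺ : Fin n → Fin (refinedSize m)
  χ⁺ u = combine (χ u) (combine (tableCode λ a b → X a b u) (tableCode λ a b → Y a b u))

  private
    module _ {u u′ : Fin n} (eq : χ⁺ u ≡ χ⁺ u′) where

      split₁ = combine-injective (χ u) _ (χ u′) _ eq
      split₂ = combine-injective (tableCode λ a b → X a b u) (tableCode λ a b → Y a b u)
                                 (tableCode λ a b → X a b u′) (tableCode λ a b → Y a b u′)
                                 (proj₂ split₁)

      sameClass : χ u ≡ χ u′
      sameClass = proj₁ split₁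

      sameX : ∀ a b → X a b u ≡ X a b u′
      sameX = tableCode-injective (proj₁ split₂)

      sameY : ∀ a b → Y a b u ≡ Y a b u′
      sameY = tableCode-injective (proj₂ split₂)

  loss⁺ : d * loss G G⁺ ≤ 2 * area Z
  loss⁺ = begin
    d * loss G G⁺         ≤⟨ *-monoʳ-≤ d (loss-prune G Z) ⟩
    d * (2 * area GZ)     ≡⟨ solve 2 (λ d a → d :* (con 2 :* a) := con 2 :* (d :* a)) refl
                                     d (area GZ) ⟩
    2 * (d * area GZ)     ≤⟨ *-monoʳ-≤ 2 Z-sparse ⟩
    2 * area Z            ∎
    where
    open +-*-Solver
    GZ : Fin n → Fin n → Bool
    GZ u v = adj G u v ∧ Z u v

  -- Refining and deleting keep vacant pairs vacant. `Z` is a union of products of refined classes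
  -- and has lost its edges, so it becomes vacant; it was not vacant before, because bad pairs have
  -- an edge.
  vacant⁺ : area (vacant G χ) + area Z ≤ area (vacant G⁺ χ⁺)
  vacant⁺ = area-pack {S = Z} still new disjoint
    where
    old : ∀ u v → Nonempty G⁺ (class χ⁺ (χ⁺ u)) (class χ⁺ (χ⁺ v)) →
          Nonempty G (class χ (χ u)) (class χ (χ v))
    old u v (u′ , v′ , u~ , v~ , a) =
      u′ , v′ , fromWitness (sameClass (toWitness u~)) , fromWitness (sameClass (toWitness v~)) ,
      prune⊆ G Z u′ v′ a

    still : ∀ u v → T (vacant G χ u v) → T (vacant G⁺ χ⁺ u v)
    still u v t = T-not⁺ λ ne → T-not⁻ t (fromWitness (old u v (toWitness ne)))

    Z-respects : ∀ {u v u′ v′} → χ⁺ u′ ≡ χ⁺ u → χ⁺ v′ ≡ χ⁺ v → Z u v ≡ Z u′ v′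
    Z-respects {u} {v} {u′} {v′} u~ v~
      rewrite sameClass u~ | sameClass v~ =
      cong₂ _∧_ (sym (sameX u~ (χ u) (χ v))) (sym (sameY v~ (χ u) (χ v)))

    Z-vacant : ∀ u v → T (Z u v) → ¬ Nonempty G⁺ (class χ⁺ (χ⁺ u)) (class χ⁺ (χ⁺ v))
    Z-vacant u v z (u′ , v′ , u~ , v~ , a) =
      prune-avoids G Z u′ v′ a (subst T (Z-respects (toWitness u~) (toWitness v~)) z)

    new : ∀ u v → T (Z u v) → T (vacant G⁺ χ⁺ u v)
    new u v z = T-not⁺ (Z-vacant u v z ∘ toWitness)

    disjoint : ∀ u v → ¬ (T (vacant G χ u v) × T (Z u v))
    disjoint u v (vac , z) = T-not⁻ vac (fromWitness
      (W.witnessˡ-nonempty (χ u) (χ v) (badClasses? (χ u) (χ v)) (proj₁ (∧⁻ {X (χ u) (χ v) u} z))))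

-- The iteration may stop at any round, hence a maximum over all rounds.
sizeBound : ℕ → ℕ → ℕ
sizeBound zero    m = m
sizeBound (suc j) m = m ⊔ sizeBound j (refinedSize m)

module _ (d r g : ℕ) where

  open ≤-Reasoning
  open +-*-Solver

  record Regularisation {n m} (G : Graph n) (χ : Fin n → Fin m) (M : ℕ) : Set where
    field
      {size}  : ℕ
      graph   : Graph n
      colour  : Fin n → Fin size
      sub     : graph ⊆ᴱ G
      small   : size ≤ M
      few-bad : g * area (Refinement.badPair graph colour d r) ≤ n * n
      -- Deleted pairs are charged to the growth of the vacant area, so that the bound telescopes
      -- over the rounds.
      cheap   : d * loss G graph + 2 * area (vacant G χ) ≤ 2 * area (vacant graph colour)

  open Regularisation

  -- g r² rounds suffice, since each raises area (vacant G χ) ≤ n² by more than n² / (g r²).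
  regularise : ∀ j {n m} (G : Graph n) (χ : Fin n → Fin m) →
    g * (r * r) * (n * n) ≤ g * (r * r) * area (vacant G χ) + j * (n * n) →
    Regularisation G χ (sizeBound j m)
  regularise j {n} {m} G χ potential with g * area (Refinement.badPair G χ d r) ≤? n * n
  ... | yes few = record
    { graph = G ; colour = χ ; sub = λ _ _ a → a ; small = m≤sizeBound j
    ; few-bad = few
    ; cheap = ≤-reflexive (cong (_+ 2 * area (vacant G χ))
                (trans (cong (d *_) no-loss) (*-zeroʳ d)))
    }
    where
    m≤sizeBound : ∀ j → m ≤ sizeBound j m
    m≤sizeBound zero    = ≤-refl
    m≤sizeBound (suc j) = m≤m⊔n m _
    no-loss : loss G G ≡ 0
    no-loss = sum-zero λ u → ∣∣-empty λ v t →
      let a , ¬a = ∧⁻ {adj G u v} t in T-not⁻ ¬a a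
  ... | no many = step j potential
    where
    open Refinement G χ d r using (Z; badArea≤; G⁺; χ⁺; loss⁺; vacant⁺)
    K  = g * (r * r)
    V  = area (vacant G χ)
    V⁺ = area (vacant G⁺ χ⁺)

    -- The bad area exceeds n²/g, so `Z` exceeds n²/(g r²), and all of `Z` becomes newly vacant.
    rise : K * V + n * n < K * V⁺
    rise = begin-strict
      K * V + n * n                            <⟨ +-monoʳ-< (K * V) (≰⇒> many) ⟩
      K * V + g * area (Refinement.badPair G χ d r)
        ≤⟨ +-monoʳ-≤ (K * V) (*-monoʳ-≤ g badArea≤) ⟩
      K * V + g * (r * r * area Z)
        ≡⟨ solve 4 (λ g s v z → g :* s :* v :+ g :* (s :* z) := g :* s :* (v :+ z)) refl
             g (r * r) V (area Z) ⟩
      K * (V + area Z)                         ≤⟨ *-monoʳ-≤ K vacant⁺ ⟩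
      K * V⁺                                   ∎

    step : ∀ j → K * (n * n) ≤ K * V + j * (n * n) → Regularisation G χ (sizeBound j m)
    -- With no round left, `K * V` has already reached `K * (n * n)`, beyond which `K * V⁺` cannot
    -- rise.
    step zero potential = contradiction (begin
      K * V⁺             ≤⟨ *-monoʳ-≤ K (area≤ (vacant G⁺ χ⁺)) ⟩
      K * (n * n)        ≤⟨ potential ⟩
      K * V + 0          ≤⟨ +-monoʳ-≤ (K * V) z≤n ⟩
      K * V + n * n      ∎) (<⇒≱ rise)
    step (suc j) potential = record
      { graph   = graph IH
      ; colour  = colour IH
      ; sub     = λ u v → prune⊆ G Z u v ∘ sub IH u v
      ; small   = ≤-trans (small IH) (m≤n⊔m m _)
      ; few-bad = few-bad IH
      ; cheap   = begin
          d * loss G (graph IH) + 2 * V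
            ≤⟨ +-monoˡ-≤ (2 * V) (*-monoʳ-≤ d (loss-triangle G G⁺ (graph IH))) ⟩
          d * (loss G G⁺ + l) + 2 * V
            ≡⟨ solve 4 (λ d a b v → d :* (a :+ b) :+ con 2 :* v := d :* a :+ (d :* b :+ con 2 :* v))
                 refl d (loss G G⁺) l V ⟩
          d * loss G G⁺ + (d * l + 2 * V)
            ≤⟨ +-monoˡ-≤ (d * l + 2 * V) loss⁺ ⟩
          2 * area Z + (d * l + 2 * V)
            ≡⟨ solve 3 (λ z l v → con 2 :* z :+ (l :+ con 2 :* v) := l :+ con 2 :* (v :+ z))
                 refl (area Z) (d * l) V ⟩
          d * l + 2 * (V + area Z)
            ≤⟨ +-monoʳ-≤ (d * l) (*-monoʳ-≤ 2 vacant⁺) ⟩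
          d * l + 2 * V⁺
            ≤⟨ cheap IH ⟩
          2 * area (vacant (graph IH) (colour IH))  ∎
      }
      where
      IH : Regularisation G⁺ χ⁺ (sizeBound j (refinedSize m))
      IH = regularise j G⁺ χ⁺ (begin
        K * (n * n)                    ≤⟨ potential ⟩
        K * V + (n * n + j * (n * n))  ≡⟨ +-assoc (K * V) (n * n) (j * (n * n)) ⟨
        K * V + n * n + j * (n * n)    ≤⟨ +-monoˡ-≤ (j * (n * n)) (<⇒≤ rise) ⟩
        K * V⁺ + j * (n * n)           ∎)
      l = loss G⁺ (graph IH)

-- Removal of the copies of H′

-- Vertices of H outside every edge may be sent to small classes; they are embedded anywhere.
partOf : Bool → Set[ n ] → Set[ n ]
partOf true  P = λ _ → true
partOf false P = P

partOf-big : ∀ {b} {P : Set[ n ]} → ¬ T b → partOf b P ≡ P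
partOf-big {b = false} _ = refl
partOf-big {b = true}  f = contradiction tt f

partOf-large : ∀ {L} {P : Set[ n ]} → L ≤ n → L ≤ ∣ partOf (∣ P ∣ <ᵇ L) P ∣
partOf-large {n} {L} {P} L≤n with ∣ P ∣ <ᵇ L in eq
... | true  = ≤-trans L≤n (≤-reflexive (sym (trans (sum-const n 1) (*-identityʳ n))))
... | false = ≮⇒≥ λ P<L → subst T eq (<⇒<ᵇ P<L)

-- At most `m` classes are small, each with fewer than `L` vertices, and every such vertex is paired
-- with all `n` vertices.
smallClasses : ∀ (χ : Fin n → Fin m) L →
               area (λ u (_ : Fin n) → ∣ class χ (χ u) ∣ <ᵇ L) ≤ n * (m * L)
smallClasses {n} {m} χ L = begin
  area (λ u (_ : Fin n) → small (χ u))
    ≡⟨ sum-cong-≗ (λ u → sum-const n (ι (small (χ u)))) ⟩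
  sum (λ u → n * ι (small (χ u)))
    ≡⟨ *-distribˡ-sum n (λ u → ι (small (χ u))) ⟨
  n * sum (λ u → ι (small (χ u)))
    ≡⟨ cong (n *_) (sum-by-class χ (λ a _ → ι (small a))) ⟩
  n * sum (λ a → sum λ u → ι (class χ a u) * ι (small a))
    ≡⟨ cong (n *_) (sum-cong-≗ λ a → *-distribʳ-sum (ι (small a)) (ι ∘ class χ a)) ⟨
  n * sum (λ a → ∣ class χ a ∣ * ι (small a))
    ≤⟨ *-monoʳ-≤ n (sum-mono bound) ⟩
  n * sum {m} (λ a → L)
    ≡⟨ cong (n *_) (sum-const m L) ⟩
  n * (m * L)  ∎
  where
  open ≤-Reasoning
  small : Fin m → Bool
  small a = ∣ class χ a ∣ <ᵇ L
  bound : ∀ a → ∣ class χ a ∣ * ι (small a) ≤ L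
  bound a with small a in eq
  ... | false = ≤-trans (≤-reflexive (*-zeroʳ ∣ class χ a ∣)) z≤n
  ... | true  = ≤-trans (≤-reflexive (*-identityʳ ∣ class χ a ∣))
                        (<⇒≤ (<ᵇ⇒< _ _ (subst T (sym eq) tt)))

-- Deletes the edges in bad pairs or at small classes. A copy of H′ that survives, composed with the
-- homomorphism from H, assigns to the edges of H regular pairs of large classes; the composite need
-- not be injective, but `embed` chooses distinct vertices.
clean : ∀ (H : Graph p) (H′ : Graph q) → Hom H H′ → ∀ {d} → 2 ≤ d →
  ∀ {M} (G : Graph n) (χ₀ : Fin n → Fin m) → Regularisation d (minReg d p) d G χ₀ M →
  minSize d p ≤ n → d * (M * minSize d p) ≤ n → Free H G →
  ∃[ G″ ] G″ ⊆ᴱ G × Free H′ G″ × d * loss G G″ ≤ 6 * (n * n)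
clean {p} {q} {n} H H′ (φ , φ-hom) {d} 2≤d {M} G χ₀ regularisation L≤n large-n G-free =
  G″ , (λ u v → sub u v ∘ prune⊆ G′ R u v) , G″-free , loss≤
  where
  L = minSize d p
  r = minReg d p
  open Regularisation regularisation renaming (graph to G′; colour to χ)
  open Refinement G′ χ d r using (badPair)

  small? : Fin n → Bool
  small? u = ∣ class χ (χ u) ∣ <ᵇ L

  R : Fin n → Fin n → Bool
  -- Testing `small?` at the first vertex suffices, as `prune` tests both orders.
  R u v = badPair u v ∨ small? u

  G″ : Graph n
  G″ = prune G′ R

  open ≤-Reasoning
  open +-*-Solver

  badArea = area (badPair)
  smallArea = area (λ u (_ : Fin n) → small? u)

  R-area : area (λ u v → adj G′ u v ∧ R u v) ≤ badArea + smallArea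
  R-area = area-cover λ u v → Equivalence.to T-∨ ∘ proj₂ ∘ ∧⁻ {adj G′ u v}

  d*small : d * smallArea ≤ n * n
  d*small = begin
    d * smallArea             ≤⟨ *-monoʳ-≤ d (smallClasses χ L) ⟩
    d * (n * (size * L))      ≤⟨ *-monoʳ-≤ d (*-monoʳ-≤ n (*-monoˡ-≤ L small)) ⟩
    d * (n * (M * L))         ≡⟨ solve 3 (λ d n k → d :* (n :* k) := n :* (d :* k)) refl
                                  d n (M * L) ⟩
    n * (d * (M * L))         ≤⟨ *-monoʳ-≤ n large-n ⟩
    n * n                     ∎

  -- 6 = 2 · 3: the vacant area, d times the bad area and d times the area at small classes are each
  -- at most n², and each enters with a factor 2.
  loss≤ : d * loss G G″ ≤ 6 * (n * n)
  loss≤ = begin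
    d * loss G G″
      ≤⟨ *-monoʳ-≤ d (loss-triangle G G′ G″) ⟩
    d * (loss G G′ + loss G′ G″)
      ≡⟨ *-distribˡ-+ d (loss G G′) (loss G′ G″) ⟩
    d * loss G G′ + d * loss G′ G″
      ≤⟨ +-mono-≤ (≤-trans (m≤m+n _ _) cheap)
                  (*-monoʳ-≤ d (≤-trans (loss-prune G′ R) (*-monoʳ-≤ 2 R-area))) ⟩
    2 * area (vacant G′ χ) + d * (2 * (badArea + smallArea))
      ≡⟨ solve 4 (λ v d a b → con 2 :* v :+ d :* (con 2 :* (a :+ b)) :=
                              con 2 :* (v :+ (d :* a :+ d :* b)))
           refl (area (vacant G′ χ)) d badArea smallArea ⟩
    2 * (area (vacant G′ χ) + (d * badArea + d * smallArea))
      ≤⟨ *-monoʳ-≤ 2 (+-mono-≤ (area≤ (vacant G′ χ)) (+-mono-≤ few-bad d*small)) ⟩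
    2 * (n * n + (n * n + n * n))
      ≡⟨ solve 1 (λ s → con 2 :* (s :+ (s :+ s)) := con 6 :* s) refl (n * n) ⟩
    6 * (n * n)  ∎

  G″-free : Free H′ G″
  G″-free (f , f-hom , _) =
    -- The copy of H is found in `G′`, to which regularity refers; `G″` only selects the pairs of
    -- classes.
    let g , _ , g-hom , g-inj = embed G′ 2≤d H C (λ x → partOf-large L≤n) reg
    in G-free (g , (λ x y → sub (g x) (g y) ∘ g-hom x y) , g-inj)
    where
    pos : Fin p → Fin n
    pos = f ∘ φ

    C : Fin p → Set[ n ]
    C x = partOf (small? (pos x)) (class χ (χ (pos x)))

    reg : ∀ x y → Adj H x y → Regular G′ d r (C x) (C y)
    reg x y x~y = subst₂ (Regular G′ d r)
      (sym (partOf-big (big u v u~v))) (sym (partOf-big (big v u (adj-sym G″ u~v))))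
      (regular G′ d r P Q λ irr → prune-avoids G′ R u v u~v
        (Equivalence.from (T-∨ {badPair u v}) (inj₁ (fromWitness {a? = bad? G′ d r P Q}
          ((u , v , class-self χ u , class-self χ v , prune⊆ G′ R u v u~v) , irr)))))
      where
      u = pos x
      v = pos y
      P = class χ (χ u)
      Q = class χ (χ v)
      u~v : Adj G″ u v
      u~v = f-hom (φ x) (φ y) (φ-hom x y x~y)
      big : ∀ u v → Adj G″ u v → ¬ T (small? u)
      big u v a s = prune-avoids G′ R u v a (Equivalence.from (T-∨ {badPair u v}) (inj₂ s))

-- Starts from a single class. A budget of `K` rounds meets the potential condition whatever the
-- vacant area, and it bounds the number of classes by `M`, independently of `n`; hence the
-- threshold.
removal : ∀ (H : Graph p) (H′ : Graph q) → Hom H H′ → ∀ d → 2 ≤ d →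
  ∃[ N ] ∀ n → n ≥ N → (G : Graph n) → Free H G →
    ∃[ G″ ] G″ ⊆ᴱ G × Free H′ G″ × d * loss G G″ ≤ 6 * (n * n)
removal {p} H H′ hom d 2≤d = L ⊔ d * (M * L) , λ n n≥N G G-free →
  clean H H′ hom 2≤d G (λ _ → zero)
    (regularise d r d K G (λ _ → zero) (m≤n+m (K * (n * n)) _))
    (≤-trans (m≤m⊔n L _) n≥N) (≤-trans (m≤n⊔m L _) n≥N) G-free
  where
  L = minSize d p
  r = minReg d p
  K = d * (r * r)
  M = sizeBound K 1

-- Counting edges, and the function h

length-filter-tabulate : ∀ {A : Set} {P : Pred A 0ℓ} (P? : Decidable P) (f : Fin n → A) →
  length (filter P? (tabulate f)) ≡ sum λ i → ι (does (P? (f i)))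
length-filter-tabulate {zero}  P? f = refl
length-filter-tabulate {suc n} P? f with does (P? (f zero))
... | true  = cong suc (length-filter-tabulate P? (f ∘ suc))
... | false = length-filter-tabulate P? (f ∘ suc)

length-filter-product : ∀ {A B : Set} {P : Pred (A × B) 0ℓ} (P? : Decidable P)
  (f : Fin m → A) (g : Fin n → B) →
  length (filter P? (cartesianProduct (tabulate f) (tabulate g))) ≡
  sum λ i → sum λ j → ι (does (P? (f i , g j)))
length-filter-product {zero}  P? f g = refl
length-filter-product {suc m} P? f g = begin
  length (filter P? (row ++ rest))
    ≡⟨ cong length (filter-++ P? row rest) ⟩
  length (filter P? row ++ filter P? rest)
    ≡⟨ length-++ (filter P? row) ⟩
  length (filter P? row) + length (filter P? rest)
    ≡⟨ cong₂ _+_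
         (trans (cong (length ∘ filter P?) (map-tabulate g (f zero ,_)))
                (length-filter-tabulate P? (λ j → f zero , g j)))
         (length-filter-product P? (f ∘ suc) g) ⟩
  sum (λ i → sum λ j → ι (does (P? (f i , g j))))  ∎
  where
  open ≡-Reasoning
  row  = map (f zero ,_) (tabulate g)
  rest = cartesianProduct (tabulate (f ∘ suc)) (tabulate g)

#edges≡area : ∀ (G : Graph n) → #edges G ≡ area λ i j → does (i <? j) ∧ adj G i j
#edges≡area G = length-filter-product (λ (i , j) → (i <? j) ×-dec T? (adj G i j)) id id

module _ (k : ℕ) .{{_ : NonZero k}} where

  -- An optimal deletion for `G′`, together with the edges of `G` outside `G′`, makes `G`
  -- colourable.
  hᴳ≤hᴳ+loss : ∀ (G G′ : Graph n) → hᴳ G k ≤ hᴳ G′ k + loss G G′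
  hᴳ≤hᴳ+loss G G′ with proj₁ (proj₂ (hᴳ-exists G′ k))
  ... | D′ , _ , #D′ , col = begin
    hᴳ G k                   ≤⟨ hᴳ-≤ G k deletable ⟩
    #edges D                 ≡⟨ #edges≡area D ⟩
    area (λ i j → does (i <? j) ∧ adj D i j)
      ≤⟨ area-cover cover ⟩
    area (λ i j → does (i <? j) ∧ adj D′ i j) + loss G G′
      ≡⟨ cong (_+ loss G G′) (trans (sym (#edges≡area D′)) #D′) ⟩
    hᴳ G′ k + loss G G′      ∎
    where
    open ≤-Reasoning
    kept = G′ ─ D′
    -- Everything in `G` outside the coloured remainder of `G′` is deleted, so what is left inherits
    -- its colouring.
    D    = G ─ kept

    G─D⊆kept : (G ─ D) ⊆ᴱ kept
    G─D⊆kept i j a with toWitness a | T? (adj kept i j)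
    ... | _      , _  | yes b = b
    ... | g      , ¬d | no ¬b = contradiction (fromWitness (g , ¬b)) ¬d

    deletable : DeletableTo G k (#edges D)
    deletable = D , (λ i j a → proj₁ (toWitness a)) , refl ,
                Colouring-⊆ᴱ {G = kept} {G ─ D} G─D⊆kept col

    cover : ∀ i j → T (does (i <? j) ∧ adj D i j) →
            T (does (i <? j) ∧ adj D′ i j) ⊎ T (adj G i j ∧ not (adj G′ i j))
    cover i j t with ∧⁻ {does (i <? j)} t
    ... | i<j , a with toWitness a | T? (adj G′ i j) | T? (adj D′ i j)
    ...   | g , _     | _      | yes d = inj₁ (∧⁺ i<j d)
    ...   | g , _     | no ¬g′ | no _  = inj₂ (∧⁺ g (T-not⁺ ¬g′))
    ...   | _ , ¬kept | yes g′ | no ¬d = contradiction (fromWitness (g′ , ¬d)) ¬kept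

  HValue⇒≤h : ∀ (H : Graph p) {n v} → HValue n k H v → v ≤ h n k H
  HValue⇒≤h H {n} val with proj₂ (h-exists n k H)
  ... | inj₁ (_ , max)  = max _ val
  ... | inj₂ (none , _) = contradiction val (none _)

  -- The value is attained by some H-free graph or is the default 0, taken when there is none.
  h-elim : ∀ (H : Graph p) n (P : Pred ℕ 0ℓ) → P 0 →
           (∀ (G : Graph n) → Free H G → P (hᴳ G k)) → P (h n k H)
  h-elim H n P P0 PG with proj₂ (h-exists n k H)
  ... | inj₁ ((G , free , eq) , _) = subst P eq (PG G free)
  ... | inj₂ (_ , h≡0)             = subst P (sym h≡0) P0

-- A positive ε = (a + 1)/b is at least 1/b, so the denominator of ε serves as `d`.
∈o-square : ∀ {e : ℕ → ℕ} →
  (∀ d → .{{NonZero d}} → ∃[ N ] ∀ n → n ≥ N → d * e n ≤ n ^ 2) → e ∈o (λ n → n ^ 2)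
∈o-square {e} small ε@(mkℚ ℤ.+[1+ a ] b-1 _) _ = let N , bound = small (suc b-1) in
  N , λ n n≥N → ℚ.toℚᵘ-cancel-≤ (begin
    ℚ.toℚᵘ (ℤ.+ e n ℚ./ 1)                    ≃⟨ ℚ.toℚᵘ-fromℚᵘ (mkℚᵘ (ℤ.+ e n) 0) ⟩
    mkℚᵘ (ℤ.+ e n) 0                          ≤⟨ *≤* (ints n (bound n n≥N)) ⟩
    ℚ.toℚᵘ ε ℚᵘ.* mkℚᵘ (ℤ.+ (n ^ 2)) 0
      ≃⟨ ℚᵘ.*-congˡ {ℚ.toℚᵘ ε} (ℚ.toℚᵘ-fromℚᵘ (mkℚᵘ (ℤ.+ (n ^ 2)) 0)) ⟨
    ℚ.toℚᵘ ε ℚᵘ.* ℚ.toℚᵘ (ℤ.+ (n ^ 2) ℚ./ 1)  ≃⟨ ℚ.toℚᵘ-homo-* ε (ℤ.+ (n ^ 2) ℚ./ 1) ⟨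
    ℚ.toℚᵘ (ε ℚ.* (ℤ.+ (n ^ 2) ℚ./ 1))        ∎)
  where
  open ℚᵘ.≤-Reasoning
  ints : ∀ n → suc b-1 * e n ≤ n ^ 2 →
         ℤ.+ e n ℤ.* ℤ.+ (suc b-1 * 1) ℤ.≤ (ℤ.+[1+ a ] ℤ.* ℤ.+ (n ^ 2)) ℤ.* ℤ.+ 1
  ints n le = subst₂ ℤ._≤_
    (trans (cong ℤ.+_ (trans (*-comm (suc b-1) (e n))
                            (cong (e n *_) (sym (*-identityʳ (suc b-1))))))
           (ℤ.pos-* (e n) (suc b-1 * 1)))
    (trans (ℤ.pos-* (suc a) (n ^ 2)) (sym (ℤ.*-identityʳ _)))
    (ℤ.+≤+ (≤-trans le (m≤n*m (n ^ 2) (suc a))))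
∈o-square small (mkℚ (ℤ.+ 0) _ _)    (ℚ.*<* (ℤ.+<+ ()))
∈o-square small (mkℚ ℤ.-[1+ _ ] _ _) (ℚ.*<* ())

theorem1p6 : ∀ {p q : ℕ} (H : Graph p) (H′ : Graph q) (k : ℕ) .{{_ : NonZero k}} →
    Contains H H′ → Hom H H′ →
    (∀ (n : ℕ) .{{_ : NonZero n}} → h n k H′ ≤ h n k H) ×
    (∃[ e ] (e ∈o (λ n → n ^ 2) ×
    (∀ (n : ℕ) .{{_ : NonZero n}} → h n k H ≤ h n k H′ + e n)))
theorem1p6 H H′ k (s , s-hom , s-inj) hom =
  -- An H′-free graph is H-free, because H contains H′ and embeddings compose.
  (λ n → h-elim k H′ n (_≤ h n k H) z≤n λ G free → HValue⇒≤h k H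
    (G , (λ (f , f-hom , f-inj) →
            free (f ∘ s , (λ i j → f-hom (s i) (s j) ∘ s-hom i j) , s-inj ∘ f-inj)) , refl)) ,
  -- With the truncated difference as error term, the upper bound is immediate and only its growth
  -- remains to be estimated.
  (λ n → h n k H ∸ h n k H′) ,
  ∈o-square small ,
  (λ n → m≤n+m∸n (h n k H) (h n k H′))
  where
  open ≤-Reasoning
  small : ∀ d → .{{NonZero d}} → ∃[ N ] ∀ n → n ≥ N → d * (h n k H ∸ h n k H′) ≤ n ^ 2
  -- Removal with parameter 6d cancels the constant 6 in its bound.
  small d = let N , remove = removal H H′ hom (6 * d) 2≤6d in
    N , λ n n≥N → *-cancelˡ-≤ 6 (begin
      6 * (d * (h n k H ∸ h n k H′))  ≡⟨ *-assoc 6 d _ ⟨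
      6 * d * (h n k H ∸ h n k H′)    ≤⟨ excess n (remove n n≥N) ⟩
      6 * (n * n)                     ≡⟨ cong (λ m → 6 * (n * m)) (*-identityʳ n) ⟨
      6 * n ^ 2                       ∎)
    where
    2≤6d : 2 ≤ 6 * d
    2≤6d = ≤-trans (s≤s (s≤s z≤n)) (*-monoʳ-≤ 6 (>-nonZero⁻¹ d))

    excess : ∀ n → (∀ (G : Graph n) → Free H G →
               ∃[ G″ ] G″ ⊆ᴱ G × Free H′ G″ × 6 * d * loss G G″ ≤ 6 * (n * n)) →
             6 * d * (h n k H ∸ h n k H′) ≤ 6 * (n * n)
    excess n remove = h-elim k H n (λ v → 6 * d * (v ∸ h n k H′) ≤ 6 * (n * n))
      (subst (_≤ 6 * (n * n))
        (sym (trans (cong (6 * d *_) (0∸n≡0 (h n k H′))) (*-zeroʳ (6 * d)))) z≤n)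
      bound
      where
      bound : ∀ (G : Graph n) → Free H G → 6 * d * (hᴳ G k ∸ h n k H′) ≤ 6 * (n * n)
      bound G G-free with remove G G-free
      ... | G″ , _ , G″-free , cheap = begin
        6 * d * (hᴳ G k ∸ h n k H′)  ≤⟨ *-monoʳ-≤ (6 * d) (m≤n+o⇒m∸n≤o (hᴳ G k) (h n k H′) (begin
          hᴳ G k                       ≤⟨ hᴳ≤hᴳ+loss k G G″ ⟩
          hᴳ G″ k + loss G G″          ≤⟨ +-monoˡ-≤ (loss G G″)
                                            (HValue⇒≤h k H′ (G″ , G″-free , refl)) ⟩
          h n k H′ + loss G G″         ∎)) ⟩
        6 * d * loss G G″            ≤⟨ cheap ⟩
        6 * (n * n)                  ∎
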